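{- Let $(\mathcal M_*,\mathcal M_{\le\omega})$ be a Büchi abstraction (with maps $\alpha_*,\gamma_*,\alpha_{\le\omega},\gamma_{\le\omega}$) that is faithful with respect to a language $\mathfrak A\subseteq\Sigma^{\le\omega}$, i.e. $\gamma_{\le\omega}(\alpha_{\le\omega}(\mathfrak A))=\mathfrak A$. Let $P$ be a Featherweight Java program that is well-typed with respect to some standard FJ class table $(F_0,M_0)$. Then the type inference algorithm $\mathcal A(P)$ described in the context yields a Büchi class table $(F,M_{\mathfrak A})$ with respect to which $P$ is well-typed.
   Context: WORDS. $\Sigma$ is a finite alphabet, $\Sigma^*$ the finite words ($\varepsilon$ the empty word), $\Sigma^{\le\omega}$ the finite and infinite words; $U\cdot V=\{uv\mid u\in U,v\in V\}$ for $U\subseteq\Sigma^*$ and $V\subseteq\Sigma^*$ or $V\subseteq\Sigma^{\le\omega}$; $U^\omega=\{u_1u_2\cdots\mid u_i\in U\}\subseteq\Sigma^{\le\omega}$. $\mathcal P$ is powerset. SYNTAX. Sets of names: variables $\mathit{Var}\ni\mathtt{this}$, classes $\mathit{Cls}\ni\mathtt{Object},\mathtt{NullType}$, fields $\mathit{Fld}$, methods $\mathit{Mtd}$, labels $\mathit{Pos}$ (a program has finitely many classes, fields, methods and labels). Expressions: $e::=x\mid\mathtt{let}\ x=e_1\ \mathtt{in}\ e_2\mid\mathtt{if}\ x=y\ \mathtt{then}\ e_1\ \mathtt{else}\ e_2\mid\mathtt{null}\mid\mathtt{new}^{\ell}\,C\mid(C)\,e\mid\mathtt{emit}(a)\mid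 x^C.m(\bar y)\mid x^C.f\mid x^C.f:=y$ with $a\in\Sigma$, $\ell\in\mathit{Pos}$; $\mathtt{NullType}$ may not occur in $\mathtt{new}$ or casts. The annotation $C$ in $x^C$ is the static class of $x$. PROGRAMS. A program $(\prec,\mathit{fields},\mathit{methods},\mathit{mtable})$ has a finite immediate-subclass relation $\prec$ on $\mathit{Cls}$, maps $\mathit{fields},\mathit{methods}$ from classes to finite sets of fields, resp. methods (including inherited ones), and a partial map $\mathit{mtable}$ from $\mathit{Cls}\times\mathit{Mtd}$ to pairs $(\bar x,e)$ (formal parameters and body). $\preceq$ is the reflexive transitive closure of $\prec$; $C\preceq\mathtt{Object}$ and $\mathtt{NullType}\preceq C$ for all $C$. Programs are well-formed: apart from $\mathtt{NullType}$ the classes form a tree with root $\mathtt{Object}$; for $C\preceq D$ with $C\neq\mathtt{NullType}$, $\mathit{fields}(D)\subseteq\mathit{fields}(C)$ and $\mathit{methods}(D)\subseteq\mathit{methods}(C)$; $\mathtt{NullType}$ has no fields or methods; $\mathit{mtable}(C,m)$ is defined iff $m\in\mathit{methods}(C)$, and methods keep their number of parameters $\mathrm{ar}(m)$ in subclasses. STANDARD FJ TYPING. A standard FJ class table consists of a field typing $F_0:\mathit{Cls}\times\mathit{Fld}\rightharpoonup\mathit{Cls}$ (invariant under subclassing) and a method typing $M_0:\mathit{Cls}\times\mathit{Mtd}\rightharpoonup\mathit{Cls}^*\times\mathit{Cls}$ (contravariant in arguments and covariant in results under subclassing). $P$ is well-typed w.r.t. it if every body $\mathit{mtable}(C,m)=(\bar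 x,e)$ with $M_0(C,m)=(\bar C,D)$ has class $D$ in the environment $\mathtt{this}{:}C,\bar x{:}\bar C$ in the usual Featherweight Java typing: variables are typed by the environment, $\mathtt{null}$ and $\mathtt{emit}(a)$ have class $\mathtt{NullType}$, $\mathtt{new}^\ell C$ and $(C)e$ have class $C$, $\mathtt{let}$ and $\mathtt{if}$ as usual, $x^C.f$, $x^C.f:=y$, $x^C.m(\bar y)$ require $x$ to have class $C$ (with $f\in\mathit{fields}(C)$, $m\in\mathit{methods}(C)$) and are typed by $F_0(C,f)$, $M_0(C,m)$, with subsumption along $\preceq$. REGIONS. $\mathit{Reg}\ni r::=\mathtt{Null}\mid\mathtt{CreatedAt}(\ell)\mid\mathtt{Unknown}$, $\ell\in\mathit{Pos}$. $\mathit{Cls}(\mathtt{Null})=\emptyset$, $\mathit{Cls}(\mathtt{CreatedAt}(\ell))=\{C\mid\text{the program contains }\mathtt{new}^\ell C\}$, $\mathit{Cls}(\mathtt{Unknown})=\mathit{Cls}$. $\mathtt{Null}$ and all $\mathtt{CreatedAt}(\ell)$ are pairwise disjoint; $\mathtt{Unknown}$ is disjoint from no region. BÜCHI ABSTRACTION. A Büchi algebra is a pair of join-semilattices $(\mathcal M_*,\mathcal M_{\le\omega})$ (order $\sqsubseteq$, join $\sqcup$) with monotone operations $\cdot:\mathcal M_*\times\mathcal M_*\to\mathcal M_*$, $\cdot:\mathcal M_*\times\mathcal M_{\le\omega}\to\mathcal M_{\le\omega}$, $(-)^\omega:\mathcal M_*\to\mathcal M_{\le\omega}$, with $\mathcal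 A\cdot(\mathcal B\cdot\mathcal U)=(\mathcal A\cdot\mathcal B)\cdot\mathcal U$ for $\mathcal A,\mathcal B\in\mathcal M_*$, $\mathcal U\in\mathcal M_*\cup\mathcal M_{\le\omega}$. A Galois insertion between partial orders $A$ and $C$ consists of monotone $\alpha:C\to A$, $\gamma:A\to C$ with $\alpha(\gamma(a))=a$ and $\gamma(\alpha(c))\sqsupseteq c$. A Büchi abstraction is a finite Büchi algebra with Galois insertions $(\alpha_*,\gamma_*)$ between $\mathcal M_*$ and $\mathcal P(\Sigma^*)$ and $(\alpha_{\le\omega},\gamma_{\le\omega})$ between $\mathcal M_{\le\omega}$ and $\mathcal P(\Sigma^{\le\omega})$ such that $\alpha_*(A\cdot B)=\alpha_*(A)\cdot\alpha_*(B)$, $\alpha_{\le\omega}(A\cdot V)=\alpha_*(A)\cdot\alpha_{\le\omega}(V)$, $\alpha_{\le\omega}(A^\omega)=\alpha_*(A)^\omega$ for all $A,B\subseteq\Sigma^*$, $V\subseteq\Sigma^{\le\omega}$. Its least elements are $\alpha_*(\emptyset)$ and $\alpha_{\le\omega}(\emptyset)$. EXPRESSIONS AND BÜCHI CLASS TABLES. For a set $K$, $\mathcal M_*\langle K\rangle$ is the set of finite partial functions from $K$ to $\mathcal M_*$; undefined entries are treated as the least element, $\emptyset$ is the empty function, and order, join and left multiplication $\mathcal U\cdot(-)$ are pointwise. $r_1\mathrel{\&}\mathcal U_1\mid\dots\mid r_n\mathrel{\&}\mathcal U_n$ denotes the element of $\mathcal M_*\langle\mathit{Reg}\rangle$ mapping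 $r_i\mapsto\mathcal U_i$. A method signature is a tuple $(C,r,m,\bar s)$ with $m\in\mathit{methods}(C)$, $r\in\mathit{Reg}$, $\bar s\in\mathit{Reg}^{\mathrm{ar}(m)}$; $\mathit{Sig}$ is the set of these. Elements $\bigsqcup_i\mathcal A_i\cdot\delta_i$ of $\mathcal M_*\langle\mathit{Sig}\rangle$ are call expressions; $\delta$ alone denotes $\alpha_*(\{\varepsilon\})\cdot\delta$. A Büchi class table $(F,M_{\mathfrak A})$ consists of $F:\mathit{Cls}\times\mathit{Reg}\times\mathit{Fld}\rightharpoonup\mathcal P(\mathit{Reg})$ (defined for $f\in\mathit{fields}(C)$) and $M_{\mathfrak A}:\mathit{Sig}\to\mathcal M_*\langle\mathit{Reg}\rangle\times\mathcal M_*\langle\mathit{Sig}\rangle$, well-formed (wherever the entries are defined): $\mathtt{Null}\in F(C,r,f)\subseteq F(C,\mathtt{Unknown},f)$; $F(C,r,f)=F(D,r,f)$ if $C\preceq D$, $f\in\mathit{fields}(D)$; $M_{\mathfrak A}(C,r,m,\bar s)\sqsubseteq M_{\mathfrak A}(D,r,m,\bar s)$ componentwise if $C\preceq D$, $m\in\mathit{methods}(D)$. BÜCHI TYPING RULES. $\Gamma:\mathit{Var}\rightharpoonup\mathit{Reg}$; judgments $\Gamma\vdash_{\mathfrak A}e:\mathcal T\ \mathsf{calls}\ \mathcal S$ are derived by (writing $\epsilon=\alpha_*(\{\varepsilon\})$): - (sub) from $\Gamma\vdash_{\mathfrak A}e:\mathcal T\ \mathsf{calls}\ \mathcal S$, $\mathcal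 T\sqsubseteq\mathcal T'$, $\mathcal S\sqsubseteq\mathcal S'$ infer $\Gamma\vdash_{\mathfrak A}e:\mathcal T'\ \mathsf{calls}\ \mathcal S'$. - (weak) from $\Gamma\vdash_{\mathfrak A}e:(r\mathrel{\&}\mathcal U)\sqcup\mathcal T\ \mathsf{calls}\ \mathcal S$ infer $\Gamma\vdash_{\mathfrak A}e:(\mathtt{Unknown}\mathrel{\&}\mathcal U)\sqcup\mathcal T\ \mathsf{calls}\ \mathcal S$. - (prim) $\Gamma\vdash_{\mathfrak A}\mathtt{emit}(a):\mathtt{Null}\mathrel{\&}\alpha_*(\{a\})\ \mathsf{calls}\ \emptyset$. (null) $\Gamma\vdash_{\mathfrak A}\mathtt{null}:\mathtt{Null}\mathrel{\&}\epsilon\ \mathsf{calls}\ \emptyset$. (new) $\Gamma\vdash_{\mathfrak A}\mathtt{new}^\ell C:\mathtt{CreatedAt}(\ell)\mathrel{\&}\epsilon\ \mathsf{calls}\ \emptyset$. (var) $\Gamma\vdash_{\mathfrak A}x:\Gamma(x)\mathrel{\&}\epsilon\ \mathsf{calls}\ \emptyset$. - (if) from $\Gamma\vdash_{\mathfrak A}e_i:\mathcal T_i\ \mathsf{calls}\ \mathcal S_i$ ($i=1,2$), $x,y\in\mathrm{dom}(\Gamma)$, infer $\Gamma\vdash_{\mathfrak A}\mathtt{if}\ x=y\ \mathtt{then}\ e_1\ \mathtt{else}\ e_2:\mathcal T_1\sqcup\mathcal T_2\ \mathsf{calls}\ \mathcal S_1\sqcup\mathcal S_2$. - (else) if $\Gamma(x),\Gamma(y)$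 are disjoint, from $\Gamma\vdash_{\mathfrak A}e_2:\mathcal T_2\ \mathsf{calls}\ \mathcal S_2$ infer $\Gamma\vdash_{\mathfrak A}\mathtt{if}\ x=y\ \mathtt{then}\ e_1\ \mathtt{else}\ e_2:\mathcal T_2\ \mathsf{calls}\ \mathcal S_2$. - (let) from $\Gamma\vdash_{\mathfrak A}e_1:r_1\mathrel{\&}\mathcal U_1\mid\dots\mid r_n\mathrel{\&}\mathcal U_n\ \mathsf{calls}\ \mathcal S$ and $\Gamma,x{:}r_i\vdash_{\mathfrak A}e_2:\mathcal T_i\ \mathsf{calls}\ \mathcal S_i$ for all $i$ infer $\Gamma\vdash_{\mathfrak A}\mathtt{let}\ x=e_1\ \mathtt{in}\ e_2:\bigsqcup_i\mathcal U_i\cdot\mathcal T_i\ \mathsf{calls}\ \mathcal S\sqcup\bigsqcup_i\mathcal U_i\cdot\mathcal S_i$. - (cast) from $\Gamma\vdash_{\mathfrak A}e:\mathcal T\ \mathsf{calls}\ \mathcal S$ infer $\Gamma\vdash_{\mathfrak A}(D)e:\mathcal T\ \mathsf{calls}\ \mathcal S$. - (get) $\Gamma\vdash_{\mathfrak A}x^C.f:\bigsqcup\{s\mathrel{\&}\epsilon\mid s\in F(C,\Gamma(x),f)\}\ \mathsf{calls}\ \emptyset$. - (set) if $\Gamma(y)\in F(C,\Gamma(x),f)$, then $\Gamma\vdash_{\mathfrak A}x^C.f:=y:\Gamma(y)\mathrel{\&}\epsilon\ \mathsf{calls}\ \emptyset$. - (call) if $r=\Gamma(x)$, $\bar s=\Gamma(\bar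 y)$, $(\mathcal T,\_)=M_{\mathfrak A}(C,r,m,\bar s)$, then $\Gamma\vdash_{\mathfrak A}x^C.m(\bar y):\mathcal T\ \mathsf{calls}\ (C,r,m,\bar s)$. $P$ is well-typed w.r.t. $(F,M_{\mathfrak A})$ if for each $(C,r,m,\bar s)\in\mathit{Sig}$ with $C\in\mathit{Cls}(r)$, $M_{\mathfrak A}(C,r,m,\bar s)=(\mathcal T,\mathcal S)$, $\mathit{mtable}(C,m)=(\bar x,e)$, the judgment $\mathtt{this}{:}r,\bar x{:}\bar s\vdash_{\mathfrak A}e:\mathcal T\ \mathsf{calls}\ \mathcal S$ is derivable. ALGORITHM $\mathcal A(P)$. Initialize $F(C,r,f):=\{\mathtt{Null}\}$ for all $C\in\mathit{Cls}$, $r\in\mathit{Reg}$, $f\in\mathit{fields}(C)$, and $M_{\mathfrak A}(C,r,m,\bar s):=(\emptyset,\emptyset)$ for all $(C,r,m,\bar s)\in\mathit{Sig}$. Repeat the following round until a full round leaves $(F,M_{\mathfrak A})$ unchanged, then return $(F,M_{\mathfrak A})$: for each $(C,r,m,\bar s)\in\mathit{Sig}$ with $C\in\mathit{Cls}(r)$ and $(C,m)\in\mathrm{dom}(\mathit{mtable})$, let $(\bar x,e)=\mathit{mtable}(C,m)$, $\Gamma=[\mathtt{this}\mapsto r]\cup[x_i\mapsto s_i]_i$, compute $(\mathcal T,\mathcal S):=\mathrm{typeff}(\Gamma,e)$, set $M_{\mathfrak A}(C,r,m,\bar s):=M_{\mathfrak A}(C,r,m,\bar s)\sqcup(\mathcal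 T,\mathcal S)$ (componentwise), and set $(F,M_{\mathfrak A}):=\mathrm{checkClassTable}(F,M_{\mathfrak A})$, which enlarges the entries, by joining offending ones, to the least well-formed table above $(F,M_{\mathfrak A})$ (e.g. if $C\preceq D$ and $F(C,r,f)\neq F(D,r,f)$, both are set to $F(C,r,f)\cup F(D,r,f)$). $\mathrm{typeff}(\Gamma,e)$, which reads the current $(F,M_{\mathfrak A})$ and may enlarge $F$, returns: - $\mathtt{emit}(a)$: $(\mathtt{Null}\mathrel{\&}\alpha_*(\{a\}),\emptyset)$; $x$: $(\Gamma(x)\mathrel{\&}\epsilon,\emptyset)$; $\mathtt{null}$: $(\mathtt{Null}\mathrel{\&}\epsilon,\emptyset)$; $\mathtt{new}^\ell C$: $(\mathtt{CreatedAt}(\ell)\mathrel{\&}\epsilon,\emptyset)$; $(D)e$: $\mathrm{typeff}(\Gamma,e)$. - $\mathtt{if}\ x=y\ \mathtt{then}\ e_1\ \mathtt{else}\ e_2$: $\mathrm{typeff}(\Gamma,e_2)$ if $\Gamma(x),\Gamma(y)$ are disjoint, else $\mathrm{typeff}(\Gamma,e_1)\sqcup\mathrm{typeff}(\Gamma,e_2)$. - $\mathtt{let}\ x=e_1\ \mathtt{in}\ e_2$: with $(r_1\mathrel{\&}\mathcal U_1\mid\dots\mid r_n\mathrel{\&}\mathcal U_n,\mathcal S)=\mathrm{typeff}(\Gamma,e_1)$ and $(\mathcal T_i,\mathcal S_i)=\mathrm{typeff}(\Gamma[x\mapsto r_i],e_2)$, returns $(\bigsqcup_i\mathcal U_i\cdot\mathcal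 T_i,\ \mathcal S\sqcup\bigsqcup_i\mathcal U_i\cdot\mathcal S_i)$. - $x^C.f$: $(\bigsqcup\{s\mathrel{\&}\epsilon\mid s\in F(C,\Gamma(x),f)\},\emptyset)$. - $x^C.f:=y$: first $F(C,\Gamma(x),f):=F(C,\Gamma(x),f)\cup\{\Gamma(y)\}$, then returns $(\Gamma(y)\mathrel{\&}\epsilon,\emptyset)$. - $x^C.m(\bar y)$: with $(\mathcal T,\_)=M_{\mathfrak A}(C,\Gamma(x),m,\Gamma(\bar y))$, returns $(\mathcal T,(C,\Gamma(x),m,\Gamma(\bar y)))$. -}

module Defs where

open import Level using (0ℓ; _⊔_) renaming (suc to lsuc)
open import Data.Bool using (Bool; true; false; _∨_) renaming (_≟_ to _≟ᵇ_)
open import Data.Empty using (⊥; ⊥-elim; ⊥-elim-irr)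
open import Data.Fin using (Fin)
open import Data.Fin.Properties using (any?) renaming (_≟_ to _≟ᶠ_)
open import Data.Fin.Subset using (Subset; _∈_; _∉_; _⊆_)
open import Data.Fin.Subset.Properties using (_∈?_)
open import Data.List using (List; []; _∷_; _++_; concat; applyUpTo; allFin; any)
open import Data.List.Membership.Propositional using () renaming (_∈_ to _∈ˡ_)
open import Data.List.Membership.Propositional.Properties using (∈-allFin)
import Data.List.Membership.DecPropositional as DecMembership
open import Data.List.Relation.Binary.Pointwise using (Pointwise)
open import Data.List.Relation.Unary.Any using (here; there)
open import Data.List.Relation.Unary.Unique.Propositional using (Unique)
open import Data.Maybe using (Maybe; just; nothing; _>>=_; fromMaybe) renaming (map to mapᵐ)
open import Data.Nat using (ℕ; zero; suc)
open import Data.Product using (Σ-syntax; ∃; ∃₂; _×_; _,_; proj₁; proj₂)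
open import Data.Product.Properties using (≡-dec)
open import Data.Sum using (_⊎_; inj₁; inj₂)
open import Data.Unit using (⊤)
open import Data.Vec using (Vec; []; _∷_; toList; lookup)
open import Data.Vec.Properties using () renaming (≡-dec to ≡-decᵛ)
import Data.Vec.Functional as VF
open import Function using (_∘_; Injective)
open import Function.Bundles using (Inverse)
open import Relation.Binary using (Rel; Poset; Setoid; DecidableEquality)
open import Relation.Binary.Construct.Closure.ReflexiveTransitive using (Star; ε; _◅_; _◅◅_)
import Relation.Binary.Construct.On as On
open import Relation.Binary.Definitions using (Monotonic₁; Monotonic₂; _Respects_)
open import Relation.Binary.Lattice using (JoinSemilattice)
open import Relation.Binary.PropositionalEquality
  using (_≡_; _≢_; refl; sym; trans; cong; cong₂; subst) renaming (setoid to ≡-setoid)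
open import Relation.Nullary using (¬_; Dec; yes; no; does)
open import Relation.Nullary.Decidable using (_×-dec_; ¬?; map′; isYes)
open import Relation.Unary using (Pred) renaming (∅ to ∅ᵖ)
open import Relation.Unary.Relation.Binary.Subset using (⊆-poset)

module _ (k : ℕ) where

  Letter : Set
  Letter = Fin k

  Word* : Set
  Word* = List Letter

  data Word≤ω : Set where
    fin : Word* → Word≤ω
    inf : (ℕ → Letter) → Word≤ω

module _ {k : ℕ} where

  infix 4 _≈ʷ_

  data _≈ʷ_ : Rel (Word≤ω k) 0ℓ where
    fin : ∀ {u v} → u ≡ v → fin u ≈ʷ fin v
    inf : ∀ {s t} → (∀ n → s n ≡ t n) → inf s ≈ʷ inf t

  ≈ʷ-sym : ∀ {v w} → v ≈ʷ w → w ≈ʷ v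
  ≈ʷ-sym (fin p) = fin (sym p)
  ≈ʷ-sym (inf p) = inf (sym ∘ p)

  ≈ʷ-trans : ∀ {u v w} → u ≈ʷ v → v ≈ʷ w → u ≈ʷ w
  ≈ʷ-trans (fin p) (fin q) = fin (trans p q)
  ≈ʷ-trans (inf p) (inf q) = inf (λ n → trans (p n) (q n))

  infixr 5 _++ˢ_ _++ʷ_

  _++ˢ_ : Word* k → (ℕ → Letter k) → ℕ → Letter k
  ([]      ++ˢ s) n       = s n
  ((a ∷ u) ++ˢ s) zero    = a
  ((a ∷ u) ++ˢ s) (suc n) = (u ++ˢ s) n

  _++ʷ_ : Word* k → Word≤ω k → Word≤ω k
  u ++ʷ fin v = fin (u ++ v)
  u ++ʷ inf s = inf (u ++ˢ s)

  _PrefixOf_ : Word* k → Word≤ω k → Set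
  u PrefixOf w = ∃ λ v → w ≈ʷ u ++ʷ v

  -- w = u₀u₁u₂⋯ : w is the least word having every u₀⋯uₙ₋₁ as a prefix.
  -- It is finite exactly when all but finitely many uᵢ are empty.
  _IsConcatOf_ : Word≤ω k → (ℕ → Word* k) → Set
  w IsConcatOf us =
      (∀ n → concat (applyUpTo us n) PrefixOf w)
    × (∀ u → u PrefixOf w → ∃ λ n → u PrefixOf fin (concat (applyUpTo us n)))

Lang* : ℕ → Set₁
Lang* k = Pred (Word* k) 0ℓ

-- Without function extensionality a predicate could distinguish letterwise
-- equal infinite words; such predicates are not sets of words.
Lang≤ω : ℕ → Set₁
Lang≤ω k = Σ[ V ∈ Pred (Word≤ω k) 0ℓ ] V Respects _≈ʷ_

lang*-poset : ℕ → Poset (lsuc 0ℓ) 0ℓ 0ℓ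
lang*-poset k = ⊆-poset (Word* k) 0ℓ

lang≤ω-poset : ℕ → Poset (lsuc 0ℓ) 0ℓ 0ℓ
lang≤ω-poset k = On.poset {B = Lang≤ω k} (⊆-poset (Word≤ω k) 0ℓ) proj₁

module _ {k : ℕ} where

  infixr 6 _·*_ _·≤ω_

  _·*_ : Lang* k → Lang* k → Lang* k
  (U ·* V) w = ∃₂ λ u v → U u × V v × w ≡ u ++ v

  _·≤ω_ : Lang* k → Lang≤ω k → Lang≤ω k
  U ·≤ω (V , _) =
      (λ w → ∃₂ λ u v → U u × V v × w ≈ʷ u ++ʷ v)
    , λ w≈w′ (u , v , u∈U , v∈V , p) → u , v , u∈U , v∈V , ≈ʷ-trans (≈ʷ-sym w≈w′) p

  _^ω : Lang* k → Lang≤ω k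
  U ^ω =
      (λ w → ∃ λ us → (∀ i → U (us i)) × w IsConcatOf us)
    , λ w≈w′ (us , us∈U , up , least) →
        us , us∈U
      , (λ n → proj₁ (up n) , ≈ʷ-trans (≈ʷ-sym w≈w′) (proj₂ (up n)))
      , (λ u (v , p) → least u (v , ≈ʷ-trans w≈w′ p))

record GaloisInsertion {a ℓ₁ ℓ₂ c ℓ₃ ℓ₄}
    (A : Poset a ℓ₁ ℓ₂) (C : Poset c ℓ₃ ℓ₄) : Set (a ⊔ ℓ₁ ⊔ ℓ₂ ⊔ c ⊔ ℓ₄) where
  private
    module A = Poset A
    module C = Poset C
  field
    α      : C.Carrier → A.Carrier
    γ      : A.Carrier → C.Carrier
    α-mono : Monotonic₁ C._≤_ A._≤_ α
    γ-mono : Monotonic₁ A._≤_ C._≤_ γ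
    αγ     : ∀ a → α (γ a) A.≈ a
    γα     : ∀ c → c C.≤ γ (α c)

Finite : Setoid 0ℓ 0ℓ → Set
Finite S = ∃ λ n → Inverse S (≡-setoid (Fin n))

record BüchiAlgebra : Set₁ where
  infixr 7 _·_ _·ω_
  field
    M*  : JoinSemilattice 0ℓ 0ℓ 0ℓ
    M≤ω : JoinSemilattice 0ℓ 0ℓ 0ℓ
  module M*  = JoinSemilattice M*
  module M≤ω = JoinSemilattice M≤ω
  field
    _·_     : M*.Carrier → M*.Carrier → M*.Carrier
    _·ω_    : M*.Carrier → M≤ω.Carrier → M≤ω.Carrier
    _^ω′    : M*.Carrier → M≤ω.Carrier
    ·-mono  : Monotonic₂ M*._≤_ M*._≤_ M*._≤_ _·_
    ·ω-mono : Monotonic₂ M*._≤_ M≤ω._≤_ M≤ω._≤_ _·ω_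
    ^ω-mono : Monotonic₁ M*._≤_ M≤ω._≤_ _^ω′
    ·-assoc : ∀ A B U → (A · (B · U)) M*.≈ ((A · B) · U)
    ·ω-assoc : ∀ A B U → (A ·ω (B ·ω U)) M≤ω.≈ ((A · B) ·ω U)

record BüchiAbstraction (k : ℕ) : Set₁ where
  field
    algebra : BüchiAlgebra
  open BüchiAlgebra algebra public
  field
    finite*  : Finite (Poset.Eq.setoid M*.poset)
    finite≤ω : Finite (Poset.Eq.setoid M≤ω.poset)
    galois*  : GaloisInsertion M*.poset (lang*-poset k)
    galois≤ω : GaloisInsertion M≤ω.poset (lang≤ω-poset k)
  open GaloisInsertion galois* public
    renaming (α to α*; γ to γ*; α-mono to α*-mono; γ-mono to γ*-mono; αγ to αγ*; γα to γα*)
  open GaloisInsertion galois≤ω public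
    renaming (α to α≤ω; γ to γ≤ω; α-mono to α≤ω-mono; γ-mono to γ≤ω-mono; αγ to αγ≤ω; γα to γα≤ω)
  field
    α*-·  : ∀ A B → α* (A ·* B) M*.≈ (α* A · α* B)
    α≤ω-· : ∀ A V → α≤ω (A ·≤ω V) M≤ω.≈ (α* A ·ω α≤ω V)
    α≤ω-ω : ∀ A → α≤ω (A ^ω) M≤ω.≈ (α* A ^ω′)

  ⊥* : M*.Carrier
  ⊥* = α* ∅ᵖ

  ε* : M*.Carrier
  ε* = α* (_≡ [])

  letter* : Letter k → M*.Carrier
  letter* a = α* (_≡ a ∷ [])

  ⊥*-least : ∀ U → ⊥* M*.≤ U
  ⊥*-least U = M*.trans (α*-mono {∅ᵖ} {γ* U} (λ ())) (M*.reflexive (αγ* U))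

Faithful : ∀ {k} → BüchiAbstraction k → Lang≤ω k → Set
Faithful {k} B 𝔄 = γ≤ω (α≤ω 𝔄) ≈ 𝔄
  where
  open BüchiAbstraction B
  open Poset (lang≤ω-poset k) using (_≈_)

record Names : Set₁ where
  field
    Var                 : Set
    _≟ᵛ_                : DecidableEquality Var
    this                : Var
    #Cls #Fld #Mtd #Pos : ℕ
    Object NullType     : Fin #Cls
    Object≢NullType     : Object ≢ NullType

  Cls Fld Mtd Pos : Set
  Cls = Fin #Cls
  Fld = Fin #Fld
  Mtd = Fin #Mtd
  Pos = Fin #Pos

  Env : Set → Set
  Env A = Var → Maybe A

  ∅ᵉ : ∀ {A} → Env A
  ∅ᵉ _ = nothing

  infixl 5 _[_↦_]

  _[_↦_] : ∀ {A} → Env A → Var → A → Env A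
  (Γ [ x ↦ a ]) y with y ≟ᵛ x
  ... | yes _ = just a
  ... | no  _ = Γ y

  [_↦*_] : ∀ {A n} → Vec Var n → Vec A n → Env A
  [ []     ↦* []     ] = ∅ᵉ
  [ x ∷ xs ↦* a ∷ as ] = [ xs ↦* as ] [ x ↦ a ]

  -- Γ(ȳ), defined when all the y's are bound and there are n of them.
  lookups : ∀ {A} → Env A → List Var → (n : ℕ) → Maybe (Vec A n)
  lookups Γ []       zero    = just []
  lookups Γ (y ∷ ys) (suc n) =
    Γ y >>= λ a → lookups Γ ys n >>= λ as → just (a ∷ as)
  lookups Γ []       (suc n) = nothing
  lookups Γ (y ∷ ys) zero    = nothing

module _ (k : ℕ) (N : Names) where
  open Names N

  data Expr : Set where
    var   : Var → Expr
    letin : (x : Var) (e₁ e₂ : Expr) → Expr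
    ifeq  : (x y : Var) (e₁ e₂ : Expr) → Expr
    null  : Expr
    new   : Pos → (C : Cls) → .(C ≢ NullType) → Expr
    cast  : (C : Cls) → .(C ≢ NullType) → Expr → Expr
    emit  : Letter k → Expr
    call  : (x : Var) (C : Cls) (m : Mtd) (ys : List Var) → Expr
    get   : (x : Var) (C : Cls) (f : Fld) → Expr
    set   : (x : Var) (C : Cls) (f : Fld) (y : Var) → Expr

  record Method (n : ℕ) : Set where
    field
      params   : Vec Var n
      distinct : Unique (this ∷ toList params)
      body     : Expr

news : ∀ {k N} → Expr k N → List (Names.Pos N × Names.Cls N)
news (letin x e₁ e₂)  = news e₁ ++ news e₂
news (ifeq x y e₁ e₂) = news e₁ ++ news e₂
news (new ℓ C _)      = (ℓ , C) ∷ []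
news (cast C _ e)     = news e
news (var x)          = []
news null             = []
news (emit a)         = []
news (call x C m ys)  = []
news (get x C f)      = []
news (set x C f y)    = []

record Program (k : ℕ) (N : Names) : Set₁ where
  open Names N
  infix 4 _≺_ _⪯_
  field
    _≺_     : Rel Cls 0ℓ
    fields  : Cls → Subset #Fld
    methods : Cls → Subset #Mtd
    ar      : Mtd → ℕ
    -- The partial map mtable is total on its domain {(C,m) | m ∈ methods(C)}.
    mtable  : ∀ C m → .(m ∈ methods C) → Method k N (ar m)

  _⪯_ : Rel Cls 0ℓ
  _⪯_ = Star _≺_

  field
    -- Apart from NullType, which is below everything and above nothing else,
    -- the classes form a tree with root Object.
    ⊀NullType     : ∀ {C} → ¬ (C ≺ NullType)
    Object⊀       : ∀ {C} → ¬ (Object ≺ C)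
    parent-unique : ∀ {C D E} → C ≢ NullType → C ≺ D → C ≺ E → D ≡ E
    ⪯Object       : ∀ C → C ⪯ Object
    NullType⪯     : ∀ C → NullType ⪯ C

    fields-⊆         : ∀ {C D} → C ≢ NullType → C ⪯ D → fields D ⊆ fields C
    methods-⊆        : ∀ {C D} → C ≢ NullType → C ⪯ D → methods D ⊆ methods C
    NullType-fields  : ∀ {f} → f ∉ fields NullType
    NullType-methods : ∀ {m} → m ∉ methods NullType

  infix 4 _⪯?_

  private
    ⪯-from : ∀ {C D} → C ⪯ Object → C ≢ NullType → Dec (C ⪯ D)
    ⪯-from {C} {D} p C≢ with C ≟ᶠ D
    ... | yes refl = yes ε
    ⪯-from ε           C≢ | no C≢D =
      no λ { ε → C≢D refl ; (q ◅ _) → Object⊀ q }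
    ⪯-from (C≺E ◅ E⪯O) C≢ | no C≢D
      with ⪯-from E⪯O (λ { refl → ⊀NullType C≺E })
    ... | yes E⪯D = yes (C≺E ◅ E⪯D)
    ... | no  E⋠D = no λ
      { ε → C≢D refl
      ; (C≺E′ ◅ E′⪯D) → E⋠D (subst (_⪯ _) (parent-unique C≢ C≺E′ C≺E) E′⪯D) }

  _⪯?_ : ∀ C D → Dec (C ⪯ D)
  C ⪯? D with C ≟ᶠ NullType
  ... | yes refl = yes (NullType⪯ D)
  ... | no  C≢   = ⪯-from (⪯Object C) C≢

module _ {k : ℕ} {N : Names} (P : Program k N) where
  open Names N
  open Program P

  record FJClassTable : Set where
    field
      F₀ : ∀ C f → .(f ∈ fields C) → Cls
      M₀ : ∀ C m → .(m ∈ methods C) → Vec Cls (ar m) × Cls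
      F₀-invariant : ∀ {C D f} → C ⪯ D → (p : f ∈ fields C) (q : f ∈ fields D) →
                     F₀ C f p ≡ F₀ D f q
      M₀-contravariant : ∀ {C D m} → C ⪯ D → (p : m ∈ methods C) (q : m ∈ methods D) →
                         ∀ i → lookup (proj₁ (M₀ D m q)) i ⪯ lookup (proj₁ (M₀ C m p)) i
      M₀-covariant     : ∀ {C D m} → C ⪯ D → (p : m ∈ methods C) (q : m ∈ methods D) →
                         proj₂ (M₀ C m p) ⪯ proj₂ (M₀ D m q)

  module _ (T₀ : FJClassTable) where
    open FJClassTable T₀

    infix 3 _⊢₀_∶_

    data _⊢₀_∶_ (Γ : Env Cls) : Expr k N → Cls → Set where
      sub  : ∀ {e C D} → Γ ⊢₀ e ∶ C → C ⪯ D → Γ ⊢₀ e ∶ D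
      var  : ∀ {x C} → Γ x ≡ just C → Γ ⊢₀ var x ∶ C
      null : Γ ⊢₀ null ∶ NullType
      emit : ∀ {a} → Γ ⊢₀ emit a ∶ NullType
      new  : ∀ {ℓ C} .{p} → Γ ⊢₀ new ℓ C p ∶ C
      cast : ∀ {C D e} .{p} → Γ ⊢₀ e ∶ D → Γ ⊢₀ cast C p e ∶ C
      letin : ∀ {x e₁ e₂ C D} → Γ ⊢₀ e₁ ∶ C → Γ [ x ↦ C ] ⊢₀ e₂ ∶ D → Γ ⊢₀ letin x e₁ e₂ ∶ D
      ifeq : ∀ {x y e₁ e₂ C D E} → Γ ⊢₀ var x ∶ D → Γ ⊢₀ var y ∶ E →
             Γ ⊢₀ e₁ ∶ C → Γ ⊢₀ e₂ ∶ C → Γ ⊢₀ ifeq x y e₁ e₂ ∶ C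
      get  : ∀ {x C f} → Γ ⊢₀ var x ∶ C → (p : f ∈ fields C) → Γ ⊢₀ get x C f ∶ F₀ C f p
      set  : ∀ {x y C f} → Γ ⊢₀ var x ∶ C → (p : f ∈ fields C) → Γ ⊢₀ var y ∶ F₀ C f p →
             Γ ⊢₀ set x C f y ∶ F₀ C f p
      call : ∀ {x C m ys} → Γ ⊢₀ var x ∶ C → (p : m ∈ methods C) →
             Pointwise (λ y D → Γ ⊢₀ var y ∶ D) ys (toList (proj₁ (M₀ C m p))) →
             Γ ⊢₀ call x C m ys ∶ proj₂ (M₀ C m p)

    FJWellTyped : Set
    FJWellTyped = ∀ C m (p : m ∈ methods C) →
      let open Method (mtable C m p) in
      [ this ∷ params ↦* C ∷ proj₁ (M₀ C m p) ] ⊢₀ body ∶ proj₂ (M₀ C m p)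

module _ (N : Names) where
  open Names N

  data Reg : Set where
    null unknown : Reg
    createdAt    : Pos → Reg

module _ {N : Names} where
  open Names N

  infix 4 _≟ʳ_

  _≟ʳ_ : DecidableEquality (Reg N)
  null        ≟ʳ null         = yes refl
  null        ≟ʳ unknown      = no λ ()
  null        ≟ʳ createdAt _  = no λ ()
  unknown     ≟ʳ null         = no λ ()
  unknown     ≟ʳ unknown      = yes refl
  unknown     ≟ʳ createdAt _  = no λ ()
  createdAt _ ≟ʳ null         = no λ ()
  createdAt _ ≟ʳ unknown      = no λ ()
  createdAt ℓ ≟ʳ createdAt ℓ′ = map′ (cong createdAt) (λ { refl → refl }) (ℓ ≟ᶠ ℓ′)

  Disjoint : Reg N → Reg N → Set
  Disjoint r s = r ≢ unknown × s ≢ unknown × r ≢ s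

  disjoint? : ∀ r s → Dec (Disjoint r s)
  disjoint? r s = ¬? (r ≟ʳ unknown) ×-dec ¬? (s ≟ʳ unknown) ×-dec ¬? (r ≟ʳ s)

  RegSet : Set
  RegSet = Reg N → Bool

  infix 4 _∈ʳ_ _⊆ʳ_ _≐ʳ_

  _∈ʳ_ : Reg N → RegSet → Set
  s ∈ʳ A = A s ≡ true

  _⊆ʳ_ _≐ʳ_ : Rel RegSet 0ℓ
  A ⊆ʳ B = ∀ s → s ∈ʳ A → s ∈ʳ B
  A ≐ʳ B = ∀ s → A s ≡ B s

  ｛_｝ : Reg N → RegSet
  ｛ s ｝ t = isYes (s ≟ʳ t)

  _∪ʳ_ : RegSet → RegSet → RegSet
  (A ∪ʳ B) s = A s ∨ B s

module _ {k : ℕ} {N : Names} (P : Program k N) where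
  open Names N
  open Program P

  infix 4 _∈Cls_ _∈Cls?_

  _∈Cls_ : Cls → Reg N → Set
  C ∈Cls null        = ⊥
  C ∈Cls unknown     = ⊤
  C ∈Cls createdAt ℓ =
    ∃ λ D → ∃ λ m → Σ[ p ∈ m ∈ methods D ] (ℓ , C) ∈ˡ news (Method.body (mtable D m p))

  _∈Cls?_ : ∀ C r → Dec (C ∈Cls r)
  C ∈Cls? null        = no λ ()
  C ∈Cls? unknown     = yes _
  C ∈Cls? createdAt ℓ = any? λ D → any? λ m → in-body? D m
    where
    open DecMembership (≡-dec _≟ᶠ_ _≟ᶠ_) using () renaming (_∈?_ to _∈ˡ?_)
    in-body? : ∀ D m → Dec (Σ[ p ∈ m ∈ methods D ] (ℓ , C) ∈ˡ news (Method.body (mtable D m p)))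
    in-body? D m with m ∈? methods D
    ... | no  m∉ = no (m∉ ∘ proj₁)
    ... | yes m∈ = map′ (m∈ ,_) proj₂ ((ℓ , C) ∈ˡ? news (Method.body (mtable D m m∈)))

  record Sig : Set where
    constructor sig
    field
      cls      : Cls
      reg      : Reg N
      mtd      : Mtd
      args     : Vec (Reg N) (ar mtd)
      .mtd∈cls : mtd ∈ methods cls

  _≟ˢ_ : DecidableEquality Sig
  sig C r m ss _ ≟ˢ sig D t n ts _ with C ≟ᶠ D | r ≟ʳ t | m ≟ᶠ n
  ... | no C≢D   | _        | _        = no λ { refl → C≢D refl }
  ... | yes _    | no r≢t   | _        = no λ { refl → r≢t refl }
  ... | yes _    | yes _    | no m≢n   = no λ { refl → m≢n refl }
  ... | yes refl | yes refl | yes refl = map′ (λ { refl → refl }) (λ { refl → refl }) (≡-decᵛ _≟ʳ_ ss ts)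

module Effects {k : ℕ} (B : BüchiAbstraction k) where
  open BüchiAbstraction B

  -- K is finite wherever this is used.
  M⟨_⟩ : Set → Set
  M⟨ K ⟩ = K → Maybe M*.Carrier

  module _ {K : Set} where

    infix  8 _!_
    infix  4 _⊑_ _≋_
    infixr 6 _⊔ᵉ_
    infixr 7 _·ᵉ_

    _!_ : M⟨ K ⟩ → K → M*.Carrier
    T ! κ = fromMaybe ⊥* (T κ)

    -- Undefined entries count as least elements.
    record _⊑_ (T T′ : M⟨ K ⟩) : Set where
      constructor pointwise
      field
        at : ∀ κ → T ! κ M*.≤ T′ ! κ

    record _≋_ (T T′ : M⟨ K ⟩) : Set where
      constructor pointwise
      field
        at : ∀ κ → T ! κ M*.≈ T′ ! κ

    ∅ : M⟨ K ⟩
    ∅ _ = nothing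

    _∨ᵐ_ : Maybe M*.Carrier → Maybe M*.Carrier → Maybe M*.Carrier
    nothing ∨ᵐ V       = V
    just U  ∨ᵐ nothing = just U
    just U  ∨ᵐ just V  = just (U M*.∨ V)

    _⊔ᵉ_ : M⟨ K ⟩ → M⟨ K ⟩ → M⟨ K ⟩
    (T ⊔ᵉ T′) κ = T κ ∨ᵐ T′ κ

    ⨆ : ∀ {n} → (Fin n → M⟨ K ⟩) → M⟨ K ⟩
    ⨆ = VF.foldr _⊔ᵉ_ ∅

    _·ᵉ_ : M*.Carrier → M⟨ K ⟩ → M⟨ K ⟩
    (U ·ᵉ T) κ = mapᵐ (U ·_) (T κ)

    single : DecidableEquality K → K → M*.Carrier → M⟨ K ⟩
    single _≟_ κ U κ′ with κ ≟ κ′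
    ... | yes _ = just U
    ... | no  _ = nothing

module BüchiTypes {k : ℕ} (B : BüchiAbstraction k) {N : Names} (P : Program k N) where
  open Names N
  open Program P
  open BüchiAbstraction B
  open Effects B public

  Type Calls : Set
  Type  = M⟨ Reg N ⟩
  Calls = M⟨ Sig P ⟩

  infix 8 _&_

  _&_ : Reg N → M*.Carrier → Type
  _&_ = single _≟ʳ_

  -- δ alone, that is α*({ε}) · δ
  ⟪_⟫ : Sig P → Calls
  ⟪ δ ⟫ = single (_≟ˢ_ P) δ ε*

  -- r₁ & U₁ | ⋯ | rₙ & Uₙ
  alternatives : ∀ {n} → (Fin n → Reg N) → (Fin n → M*.Carrier) → Type
  alternatives r U = ⨆ λ i → r i & U i

  -- ⊔ { s & ε | s ∈ A }
  anyOf : RegSet → Type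
  anyOf A s with A s
  ... | true  = just ε*
  ... | false = nothing

  FieldTable MethodTable : Set
  FieldTable  = ∀ C → Reg N → ∀ f → .(f ∈ fields C) → RegSet {N}
  MethodTable = Sig P → Type × Calls

  Table : Set
  Table = FieldTable × MethodTable

  infix 4 _⊑ᶠ_ _⊑ᵐ_ _⊑ᵗ_ _≋ᵗ_

  _⊑ᶠ_ : Rel FieldTable 0ℓ
  F ⊑ᶠ F′ = ∀ C r f (p : f ∈ fields C) → F C r f p ⊆ʳ F′ C r f p

  _⊑ᵐ_ : Rel MethodTable 0ℓ
  M ⊑ᵐ M′ = ∀ σ → proj₁ (M σ) ⊑ proj₁ (M′ σ) × proj₂ (M σ) ⊑ proj₂ (M′ σ)

  _⊑ᵗ_ _≋ᵗ_ : Rel Table 0ℓ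
  (F , M) ⊑ᵗ (F′ , M′) = F ⊑ᶠ F′ × M ⊑ᵐ M′
  (F , M) ≋ᵗ (F′ , M′) =
      (∀ C r f (p : f ∈ fields C) → F C r f p ≐ʳ F′ C r f p)
    × (∀ σ → proj₁ (M σ) ≋ proj₁ (M′ σ) × proj₂ (M σ) ≋ proj₂ (M′ σ))

  record WellFormed (T : Table) : Set where
    F = proj₁ T
    M = proj₂ T
    field
      null-∈    : ∀ C r f (p : f ∈ fields C) → null ∈ʳ F C r f p
      ⊆-unknown : ∀ C r f (p : f ∈ fields C) → F C r f p ⊆ʳ F C unknown f p
      F-class   : ∀ {C D} → C ⪯ D → ∀ r f (p : f ∈ fields C) (q : f ∈ fields D) →
                  F C r f p ≐ʳ F D r f q
      M-class   : ∀ {C D} → C ⪯ D → ∀ r m ss (p : m ∈ methods C) (q : m ∈ methods D) →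
                  let T₁ , S₁ = M (sig C r m ss p)
                      T₂ , S₂ = M (sig D r m ss q)
                  in T₁ ⊑ T₂ × S₁ ⊑ S₂

  module _ (T : Table) where
    private
      F = proj₁ T
      M = proj₂ T

    infix 3 _⊢_∶_calls_

    data _⊢_∶_calls_ (Γ : Env (Reg N)) : Expr k N → Type → Calls → Set where
      sub   : ∀ {e T T′ S S′} → Γ ⊢ e ∶ T calls S → T ⊑ T′ → S ⊑ S′ → Γ ⊢ e ∶ T′ calls S′
      weak  : ∀ {e r U T S} → Γ ⊢ e ∶ (r & U) ⊔ᵉ T calls S → Γ ⊢ e ∶ (unknown & U) ⊔ᵉ T calls S
      prim  : ∀ {a} → Γ ⊢ emit a ∶ null & letter* a calls ∅
      null  : Γ ⊢ null ∶ null & ε* calls ∅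
      new   : ∀ {ℓ C} .{p} → Γ ⊢ new ℓ C p ∶ createdAt ℓ & ε* calls ∅
      var   : ∀ {x r} → Γ x ≡ just r → Γ ⊢ var x ∶ r & ε* calls ∅
      ifeq  : ∀ {x y r s e₁ e₂ T₁ T₂ S₁ S₂} → Γ x ≡ just r → Γ y ≡ just s →
              Γ ⊢ e₁ ∶ T₁ calls S₁ → Γ ⊢ e₂ ∶ T₂ calls S₂ →
              Γ ⊢ ifeq x y e₁ e₂ ∶ T₁ ⊔ᵉ T₂ calls S₁ ⊔ᵉ S₂
      else  : ∀ {x y r s e₁ e₂ T₂ S₂} → Γ x ≡ just r → Γ y ≡ just s → Disjoint r s →
              Γ ⊢ e₂ ∶ T₂ calls S₂ → Γ ⊢ ifeq x y e₁ e₂ ∶ T₂ calls S₂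
      letin : ∀ {x e₁ e₂ S n}
              (r : Fin n → Reg N) (U : Fin n → M*.Carrier) → Injective _≡_ _≡_ r →
              (T : Fin n → Type) (S′ : Fin n → Calls) →
              Γ ⊢ e₁ ∶ alternatives r U calls S →
              (∀ i → Γ [ x ↦ r i ] ⊢ e₂ ∶ T i calls S′ i) →
              Γ ⊢ letin x e₁ e₂ ∶ (⨆ λ i → U i ·ᵉ T i) calls (S ⊔ᵉ ⨆ λ i → U i ·ᵉ S′ i)
      cast  : ∀ {D e T S} .{p} → Γ ⊢ e ∶ T calls S → Γ ⊢ cast D p e ∶ T calls S
      get   : ∀ {x C f r} → Γ x ≡ just r → (p : f ∈ fields C) →
              Γ ⊢ get x C f ∶ anyOf (F C r f p) calls ∅
      set   : ∀ {x y C f r s} → Γ x ≡ just r → Γ y ≡ just s → (p : f ∈ fields C) →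
              s ∈ʳ F C r f p → Γ ⊢ set x C f y ∶ s & ε* calls ∅
      call  : ∀ {x C m ys r ss} → Γ x ≡ just r → lookups Γ ys (ar m) ≡ just ss →
              (p : m ∈ methods C) → let σ = sig C r m ss p in
              Γ ⊢ call x C m ys ∶ proj₁ (M σ) calls ⟪ σ ⟫

    WellTyped : Set
    WellTyped = ∀ C r m ss (p : m ∈ methods C) → _∈Cls_ P C r →
      let open Method (mtable C m p)
          T , S = M (sig C r m ss p)
      in [ this ∷ params ↦* r ∷ ss ] ⊢ body ∶ T calls S

record Enumeration (A : Set) : Set where
  field
    list     : List A
    complete : ∀ a → a ∈ˡ list
    unique   : Unique list

-- The order in which a round visits the signatures, and the order in which
-- the alternatives r₁ & U₁ | ⋯ | rₙ & Uₙ are listed, are left open.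
module Inference {k : ℕ} (B : BüchiAbstraction k) {N : Names} (P : Program k N)
                 (regs : Enumeration (Reg N)) (sigs : Enumeration (Sig P)) where
  open Names N
  open Program P
  open BüchiAbstraction B
  open BüchiTypes B P

  initial : Table
  initial = (λ C r f p → ｛ null ｝) , λ σ → ∅ , ∅

  _[_,_,_∪=_] : FieldTable → Cls → Reg N → Fld → Reg N → FieldTable
  (F [ C , r , f ∪= s ]) C′ r′ f′ p with (C ≟ᶠ C′) ×-dec (r ≟ʳ r′) ×-dec (f ≟ᶠ f′)
  ... | yes _ = F C′ r′ f′ p ∪ʳ ｛ s ｝
  ... | no  _ = F C′ r′ f′ p

  _[_⊔=_] : MethodTable → Sig P → Type × Calls → MethodTable
  (M [ σ ⊔= (T , S) ]) σ′ with _≟ˢ_ P σ σ′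
  ... | yes _ = proj₁ (M σ′) ⊔ᵉ T , proj₂ (M σ′) ⊔ᵉ S
  ... | no  _ = M σ′

  module _ (M : MethodTable) where

    -- The field table is threaded through; nothing means that a variable is
    -- unbound, a member does not exist, or a call has the wrong arity.
    typeff   : FieldTable → Env (Reg N) → Expr k N → Maybe (FieldTable × Type × Calls)
    branches : FieldTable → Env (Reg N) → Var → Type → Expr k N → List (Reg N) →
               Maybe (FieldTable × Type × Calls)

    typeff F Γ (var x)     = Γ x >>= λ r → just (F , r & ε* , ∅)
    typeff F Γ null        = just (F , null & ε* , ∅)
    typeff F Γ (emit a)    = just (F , null & letter* a , ∅)
    typeff F Γ (new ℓ C _) = just (F , createdAt ℓ & ε* , ∅)
    typeff F Γ (cast D _ e) = typeff F Γ e
    typeff F Γ (ifeq x y e₁ e₂) =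
      Γ x >>= λ r → Γ y >>= λ s → choose (does (disjoint? r s))
      where
      choose : Bool → Maybe (FieldTable × Type × Calls)
      choose true  = typeff F Γ e₂
      choose false =
        typeff F  Γ e₁ >>= λ (F₁ , T₁ , S₁) →
        typeff F₁ Γ e₂ >>= λ (F₂ , T₂ , S₂) →
        just (F₂ , T₁ ⊔ᵉ T₂ , S₁ ⊔ᵉ S₂)
    typeff F Γ (letin x e₁ e₂) =
      typeff F Γ e₁ >>= λ (F₁ , T₁ , S₁) →
      branches F₁ Γ x T₁ e₂ (Enumeration.list regs) >>= λ (F₂ , T₂ , S₂) →
      just (F₂ , T₂ , S₁ ⊔ᵉ S₂)
    typeff F Γ (get x C f) with f ∈? fields C
    ... | yes p = Γ x >>= λ r → just (F , anyOf (F C r f p) , ∅)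
    ... | no  _ = nothing
    typeff F Γ (set x C f y) with f ∈? fields C
    ... | yes _ = Γ x >>= λ r → Γ y >>= λ s → just (F [ C , r , f ∪= s ] , s & ε* , ∅)
    ... | no  _ = nothing
    typeff F Γ (call x C m ys) with m ∈? methods C
    ... | yes p = Γ x >>= λ r → lookups Γ ys (ar m) >>= λ ss →
                  let σ = sig C r m ss p in just (F , proj₁ (M σ) , ⟪ σ ⟫)
    ... | no  _ = nothing

    -- (⊔ᵢ Uᵢ · Tᵢ , ⊔ᵢ Uᵢ · Sᵢ), where rᵢ ranges over the domain of T.
    branches F Γ x T e []       = just (F , ∅ , ∅)
    branches F Γ x T e (r ∷ rs) with T r
    ... | nothing = branches F Γ x T e rs
    ... | just U  =
      typeff F (Γ [ x ↦ r ]) e >>= λ (F₁ , T₁ , S₁) →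
      branches F₁ Γ x T e rs   >>= λ (F₂ , T₂ , S₂) →
      just (F₂ , U ·ᵉ T₁ ⊔ᵉ T₂ , U ·ᵉ S₁ ⊔ᵉ S₂)

  -- C and D have a common superclass with field f.  As the classes form a
  -- tree, this is the equivalence relation on {C | f ∈ fields(C)} generated
  -- by ⪯, so the entries for f at C and D have to agree.
  Linked : Fld → Rel Cls 0ℓ
  Linked f C D = ∃ λ E → f ∈ fields E × C ⪯ E × D ⪯ E

  linked? : ∀ f C D → Dec (Linked f C D)
  linked? f C D = any? λ E → f ∈? fields E ×-dec C ⪯? E ×-dec D ⪯? E

  entry : FieldTable → Cls → Reg N → Fld → RegSet
  entry F D r f s with f ∈? fields D
  ... | yes p = F D r f p s
  ... | no  _ = false

  closeClasses closeUnknown : FieldTable → FieldTable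
  closeClasses F C r f _ s =
    isYes (null ≟ʳ s) ∨ isYes (any? λ D → linked? f C D ×-dec (entry F D r f s ≟ᵇ true))
  closeUnknown F C unknown f p s = any (λ r → F C r f p s) (Enumeration.list regs)
  closeUnknown F C r       f p s = F C r f p s

  joinSubclasses : MethodTable → ∀ C → Reg N → ∀ m → Vec (Reg N) (ar m) → List Cls → Type × Calls
  joinSubclasses M C r m ss []       = ∅ , ∅
  joinSubclasses M C r m ss (D ∷ Ds) with D ⪯? C | m ∈? methods D
  ... | yes _ | yes p = let T  , S  = M (sig D r m ss p)
                            T′ , S′ = joinSubclasses M C r m ss Ds
                        in T ⊔ᵉ T′ , S ⊔ᵉ S′
  ... | _     | _     = joinSubclasses M C r m ss Ds

  closeMethods : MethodTable → MethodTable
  closeMethods M (sig C r m ss _) = joinSubclasses M C r m ss (allFin #Cls)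

  -- The least well-formed table above T: see checkClassTable-wellFormed,
  -- checkClassTable-above and checkClassTable-least.
  checkClassTable : Table → Table
  checkClassTable (F , M) = closeUnknown (closeClasses F) , closeMethods M

  ∨-introˡ : ∀ {a b} → a ≡ true → a ∨ b ≡ true
  ∨-introˡ refl = refl

  ∨-introʳ : ∀ {a b} → b ≡ true → a ∨ b ≡ true
  ∨-introʳ {true}  _ = refl
  ∨-introʳ {false} p = p

  ∨-elim : ∀ {a b} → a ∨ b ≡ true → a ≡ true ⊎ b ≡ true
  ∨-elim {true}  _ = inj₁ refl
  ∨-elim {false} p = inj₂ p

  isYes-intro : ∀ {A : Set} (d : Dec A) → A → isYes d ≡ true
  isYes-intro (yes _) _ = refl
  isYes-intro (no ¬a) a = ⊥-elim (¬a a)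

  isYes-elim : ∀ {A : Set} (d : Dec A) → isYes d ≡ true → A
  isYes-elim (yes a) _ = a

  any-intro : ∀ {A : Set} (p : A → Bool) {x xs} → x ∈ˡ xs → p x ≡ true → any p xs ≡ true
  any-intro p (here refl) px = ∨-introˡ px
  any-intro p {xs = y ∷ _} (there x∈) px = ∨-introʳ {p y} (any-intro p x∈ px)

  any-elim : ∀ {A : Set} (p : A → Bool) xs → any p xs ≡ true → ∃ λ x → p x ≡ true
  any-elim p (x ∷ xs) h with ∨-elim {p x} h
  ... | inj₁ px = x , px
  ... | inj₂ h′ = any-elim p xs h′

  ≐ʳ-from-⊆ʳ : {A A′ : RegSet {N}} → A ⊆ʳ A′ → A′ ⊆ʳ A → A ≐ʳ A′
  ≐ʳ-from-⊆ʳ {A} {A′} i j s with A s in eq | A′ s in eq′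
  ... | true  | true  = refl
  ... | false | false = refl
  ... | true  | false = trans (sym (i s eq)) eq′
  ... | false | true  = trans (sym eq) (j s eq′)

  entry-≡ : ∀ F D r f s (p : f ∈ fields D) → entry F D r f s ≡ F D r f p s
  entry-≡ F D r f s p with f ∈? fields D
  ... | yes _ = refl
  ... | no f∉ = ⊥-elim (f∉ p)

  entry-∈ : ∀ F D r f s → entry F D r f s ≡ true → Σ[ p ∈ f ∈ fields D ] s ∈ʳ F D r f p
  entry-∈ F D r f s h with f ∈? fields D
  ... | yes p = p , h

  ¬NullType : ∀ {C f} → f ∈ fields C → C ≢ NullType
  ¬NullType p refl = NullType-fields p

  superclasses-comparable : ∀ {C D E} → C ≢ NullType → C ⪯ D → C ⪯ E → D ⪯ E ⊎ E ⪯ D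
  superclasses-comparable C≢ ε C⪯E = inj₁ C⪯E
  superclasses-comparable C≢ C⪯D ε = inj₂ C⪯D
  superclasses-comparable C≢ (p ◅ ps) (q ◅ qs) with parent-unique C≢ p q
  ... | refl = superclasses-comparable (λ { refl → ⊀NullType p }) ps qs

  linked-up : ∀ {f C D X} → f ∈ fields C → f ∈ fields D → C ⪯ D → Linked f C X → Linked f D X
  linked-up {D = D} p q C⪯D (E , e , C⪯E , X⪯E)
    with superclasses-comparable (¬NullType p) C⪯D C⪯E
  ... | inj₁ D⪯E = E , e , D⪯E , X⪯E
  ... | inj₂ E⪯D = D , q , ε , X⪯E ◅◅ E⪯D

  linked-down : ∀ {f C D X} → C ⪯ D → Linked f D X → Linked f C X
  linked-down C⪯D (E , e , D⪯E , X⪯E) = E , e , C⪯D ◅◅ D⪯E , X⪯E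

  module _ (F : FieldTable) where

    closeClasses-null : ∀ C r f (p : f ∈ fields C) → null ∈ʳ closeClasses F C r f p
    closeClasses-null C r f p = refl

    closeClasses-intro : ∀ {C D r f s} (p : f ∈ fields C) (q : f ∈ fields D) →
                         Linked f C D → s ∈ʳ F D r f q → s ∈ʳ closeClasses F C r f p
    closeClasses-intro {C} {D} {r} {f} {s} p q l s∈ =
      ∨-introʳ {isYes (null ≟ʳ s)}
        (isYes-intro (any? λ D → linked? f C D ×-dec (entry F D r f s ≟ᵇ true))
          (D , l , trans (entry-≡ F D r f s q) s∈))

    closeClasses-elim : ∀ {C r f s} (p : f ∈ fields C) → s ∈ʳ closeClasses F C r f p →
                        null ≡ s ⊎ ∃ λ D → Linked f C D × Σ[ q ∈ f ∈ fields D ] s ∈ʳ F D r f q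
    closeClasses-elim {C} {r} {f} {s} p h with ∨-elim {isYes (null ≟ʳ s)} h
    ... | inj₁ h₁ = inj₁ (isYes-elim (null ≟ʳ s) h₁)
    ... | inj₂ h₂
      with isYes-elim (any? λ D → linked? f C D ×-dec (entry F D r f s ≟ᵇ true)) h₂
    ... | D , l , e = inj₂ (D , l , entry-∈ F D r f s e)

    closeClasses-class : ∀ {C D} → C ⪯ D → ∀ r f (p : f ∈ fields C) (q : f ∈ fields D) →
                         closeClasses F C r f p ≐ʳ closeClasses F D r f q
    closeClasses-class {C} {D} C⪯D r f p q = ≐ʳ-from-⊆ʳ up down
      where
      up : closeClasses F C r f p ⊆ʳ closeClasses F D r f q
      up s h with closeClasses-elim p h
      ... | inj₁ refl = refl
      ... | inj₂ (X , l , x , s∈) = closeClasses-intro q x (linked-up p q C⪯D l) s∈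
      down : closeClasses F D r f q ⊆ʳ closeClasses F C r f p
      down s h with closeClasses-elim q h
      ... | inj₁ refl = refl
      ... | inj₂ (X , l , x , s∈) = closeClasses-intro p x (linked-down C⪯D l) s∈

    closeUnknown-above : F ⊑ᶠ closeUnknown F
    closeUnknown-above C null          f p s h = h
    closeUnknown-above C unknown       f p s h =
      any-intro (λ r → F C r f p s) (Enumeration.complete regs unknown) h
    closeUnknown-above C (createdAt _) f p s h = h

    closeUnknown-⊆ : ∀ C r f (p : f ∈ fields C) →
                     closeUnknown F C r f p ⊆ʳ closeUnknown F C unknown f p
    closeUnknown-⊆ C null f p s h =
      any-intro (λ r → F C r f p s) (Enumeration.complete regs null) h
    closeUnknown-⊆ C unknown f p s h = h
    closeUnknown-⊆ C (createdAt ℓ) f p s h =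
      any-intro (λ r → F C r f p s) (Enumeration.complete regs (createdAt ℓ)) h

    closeUnknown-class :
      (∀ {C D} → C ⪯ D → ∀ r f (p : f ∈ fields C) (q : f ∈ fields D) → F C r f p ≐ʳ F D r f q) →
      ∀ {C D} → C ⪯ D → ∀ r f (p : f ∈ fields C) (q : f ∈ fields D) →
      closeUnknown F C r f p ≐ʳ closeUnknown F D r f q
    closeUnknown-class cls C⪯D null          f p q s = cls C⪯D null f p q s
    closeUnknown-class cls C⪯D (createdAt ℓ) f p q s = cls C⪯D (createdAt ℓ) f p q s
    closeUnknown-class cls {C} {D} C⪯D unknown f p q s = go (Enumeration.list regs)
      where
      go : ∀ rs → any (λ r → F C r f p s) rs ≡ any (λ r → F D r f q s) rs
      go []       = refl
      go (r ∷ rs) = cong₂ _∨_ (cls C⪯D r f p q s) (go rs)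

  module _ {K : Set} where

    ⊑-trans : {T₁ T₂ T₃ : M⟨ K ⟩} → T₁ ⊑ T₂ → T₂ ⊑ T₃ → T₁ ⊑ T₃
    ⊑-trans (pointwise p) (pointwise q) = pointwise λ κ → M*.trans (p κ) (q κ)

    ∅-least : {T : M⟨ K ⟩} → ∅ ⊑ T
    ∅-least {T} = pointwise λ κ → ⊥*-least (T ! κ)

    ⊔-upperˡ : (T T′ : M⟨ K ⟩) → T ⊑ T ⊔ᵉ T′
    ⊔-upperˡ T T′ = pointwise at
      where
      at : ∀ κ → T ! κ M*.≤ (T ⊔ᵉ T′) ! κ
      at κ with T κ | T′ κ
      ... | nothing | V       = ⊥*-least (fromMaybe ⊥* V)
      ... | just U  | nothing = M*.refl
      ... | just U  | just V  = M*.x≤x∨y U V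

    ⊔-upperʳ : (T T′ : M⟨ K ⟩) → T′ ⊑ T ⊔ᵉ T′
    ⊔-upperʳ T T′ = pointwise at
      where
      at : ∀ κ → T′ ! κ M*.≤ (T ⊔ᵉ T′) ! κ
      at κ with T κ | T′ κ
      ... | nothing | V       = M*.refl
      ... | just U  | nothing = ⊥*-least U
      ... | just U  | just V  = M*.y≤x∨y U V

    ⊔-least : {T T′ T″ : M⟨ K ⟩} → T ⊑ T″ → T′ ⊑ T″ → T ⊔ᵉ T′ ⊑ T″
    ⊔-least {T} {T′} {T″} (pointwise p) (pointwise q) = pointwise at
      where
      at : ∀ κ → (T ⊔ᵉ T′) ! κ M*.≤ T″ ! κ
      at κ with T κ | T′ κ | p κ | q κ
      ... | nothing | V       | _ | v = v
      ... | just U  | nothing | u | _ = u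
      ... | just U  | just V  | u | v = M*.∨-least u v

  _⊑²_ : Rel (Type × Calls) 0ℓ
  (T , S) ⊑² (T′ , S′) = T ⊑ T′ × S ⊑ S′

  module _ (M : MethodTable) where

    joinAll-upper : ∀ C r m ss (p : m ∈ methods C) {D} Ds → D ∈ˡ Ds → D ⪯ C →
                    (q : m ∈ methods D) → M (sig D r m ss q) ⊑² joinSubclasses M C r m ss Ds
    joinAll-upper C r m ss p {D} (_ ∷ Ds) (here refl) D⪯C q with D ⪯? C | m ∈? methods D
    ... | yes _ | yes _ = ⊔-upperˡ _ _ , ⊔-upperˡ _ _
    ... | yes _ | no m∉ = ⊥-elim (m∉ q)
    ... | no D⋠ | _     = ⊥-elim (D⋠ D⪯C)
    joinAll-upper C r m ss p (X ∷ Ds) (there D∈) D⪯C q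
      with joinAll-upper C r m ss p Ds D∈ D⪯C q | X ⪯? C | m ∈? methods X
    ... | t , u | yes _ | yes _ = ⊑-trans t (⊔-upperʳ _ _) , ⊑-trans u (⊔-upperʳ _ _)
    ... | t , u | yes _ | no  _ = t , u
    ... | t , u | no  _ | _     = t , u

    joinAll-least : ∀ C r m ss (p : m ∈ methods C) Z Ds →
                    (∀ {D} → D ⪯ C → (q : m ∈ methods D) → M (sig D r m ss q) ⊑² Z) →
                    joinSubclasses M C r m ss Ds ⊑² Z
    joinAll-least C r m ss p Z [] h = ∅-least , ∅-least
    joinAll-least C r m ss p Z (X ∷ Ds) h
      with joinAll-least C r m ss p Z Ds h | X ⪯? C | m ∈? methods X
    ... | t , u | yes X⪯C | yes q = ⊔-least (proj₁ (h X⪯C q)) t , ⊔-least (proj₂ (h X⪯C q)) u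
    ... | t , u | yes _   | no  _ = t , u
    ... | t , u | no  _   | _     = t , u

    closeMethods-intro : ∀ {C D} r m ss (p : m ∈ methods C) (q : m ∈ methods D) → D ⪯ C →
                         M (sig D r m ss q) ⊑² closeMethods M (sig C r m ss p)
    closeMethods-intro {C} {D} r m ss p q D⪯C =
      joinAll-upper C r m ss p (allFin #Cls) (∈-allFin D) D⪯C q

  checkClassTable-wellFormed : ∀ T → WellFormed (checkClassTable T)
  checkClassTable-wellFormed (F , M) = record
    { null-∈    = λ C r f p → closeUnknown-above F₁ C r f p null (closeClasses-null F C r f p)
    ; ⊆-unknown = closeUnknown-⊆ F₁
    ; F-class   = closeUnknown-class F₁ (closeClasses-class F)
    ; M-class   = λ {C} {D} C⪯D r m ss p q →
        joinAll-least M C r m ss p (closeMethods M (sig D r m ss q)) (allFin #Cls) λ X⪯C x →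
          closeMethods-intro M r m ss q x (X⪯C ◅◅ C⪯D)
    }
    where F₁ = closeClasses F

  checkClassTable-above : ∀ T → T ⊑ᵗ checkClassTable T
  checkClassTable-above (F , M) =
      (λ C r f p s h → closeUnknown-above (closeClasses F) C r f p s
                         (closeClasses-intro F p p (C , p , ε , ε) h))
    , λ { σ@(sig C r m ss p) → closeMethods-above C r m ss p (m ∈? methods C) }
    where
    closeMethods-above : ∀ C r m ss .(p : m ∈ methods C) → Dec (m ∈ methods C) →
                         M (sig C r m ss p) ⊑² closeMethods M (sig C r m ss p)
    closeMethods-above C r m ss p (yes q) = closeMethods-intro M r m ss q q ε
    closeMethods-above C r m ss p (no ¬p) = ⊥-elim-irr (¬p p)

  checkClassTable-least : ∀ T T′ → WellFormed T′ → T ⊑ᵗ T′ → checkClassTable T ⊑ᵗ T′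
  checkClassTable-least (F , M) (F′ , M′) wf (F⊑F′ , M⊑M′) = fields-least , methods-least
    where
    open WellFormed wf using (null-∈; ⊆-unknown; F-class; M-class)

    classes-least : closeClasses F ⊑ᶠ F′
    classes-least C r f p s h with closeClasses-elim F p h
    ... | inj₁ refl = null-∈ C r f p
    ... | inj₂ (D , (E , e , C⪯E , D⪯E) , q , s∈) =
      trans (F-class C⪯E r f p e s)
        (trans (sym (F-class D⪯E r f q e s)) (F⊑F′ D r f q s s∈))

    fields-least : closeUnknown (closeClasses F) ⊑ᶠ F′
    fields-least C null          f p s h = classes-least C null f p s h
    fields-least C (createdAt ℓ) f p s h = classes-least C (createdAt ℓ) f p s h
    fields-least C unknown       f p s h
      with any-elim (λ r → closeClasses F C r f p s) (Enumeration.list regs) h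
    ... | r , h′ = ⊆-unknown C r f p s (classes-least C r f p s h′)

    least-at : ∀ C r m ss .(p : m ∈ methods C) → Dec (m ∈ methods C) →
               closeMethods M (sig C r m ss p) ⊑² M′ (sig C r m ss p)
    least-at C r m ss p (no ¬p) = ⊥-elim-irr (¬p p)
    least-at C r m ss p (yes p′) =
      joinAll-least M C r m ss p′ (M′ (sig C r m ss p′)) (allFin #Cls) λ {D} D⪯C q →
        let t , u   = M⊑M′ (sig D r m ss q)
            t′ , u′ = M-class D⪯C r m ss q p′
        in ⊑-trans t t′ , ⊑-trans u u′

    methods-least : closeMethods M ⊑ᵐ M′
    methods-least (sig C r m ss p) = least-at C r m ss p (m ∈? methods C)

  visit : Sig P → Table → Maybe Table
  visit σ@(sig C r m ss p) (F , M) with _∈Cls?_ P C r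
  ... | no  _ = just (F , M)
  ... | yes _ =
    let open Method (mtable C m p) in
    typeff M F [ this ∷ params ↦* r ∷ ss ] body >>= λ (F′ , T , S) →
    just (checkClassTable (F′ , M [ σ ⊔= (T , S) ]))

  visitAll : List (Sig P) → Table → Maybe Table
  visitAll []       T = just T
  visitAll (σ ∷ σs) T = visit σ T >>= visitAll σs

  round : Table → Maybe Table
  round = visitAll (Enumeration.list sigs)

  infix 4 _⇓_

  -- Repeating rounds from the first table terminates and returns the second.
  data _⇓_ (T : Table) : Table → Set where
    stop  : ∀ {T′} → round T ≡ just T′ → T′ ≋ᵗ T → T ⇓ T′
    again : ∀ {T′ T″} → round T ≡ just T′ → ¬ (T′ ≋ᵗ T) → T′ ⇓ T″ → T ⇓ T″

  Returns : Table → Set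
  Returns T = initial ⇓ T

module Submission where

-- The algorithm never fails, never runs forever, and what it has computed when
-- it stops is, up to equivalence, a fixed point of a round; at a fixed point, the
-- effects inferred for a body lie below the table entry of its signature.
--
-- Failure.  typeff is undefined only if a variable is unbound, a member does
-- not exist or a call has the wrong arity, and an FJ typing of the body excludes
-- all three.  Hence the induction that shows that typeff succeeds runs over the
-- FJ derivation (typeff-sound), and the regions assigned to the variables only
-- have to be defined wherever the FJ environment is (Covers).
--
-- Soundness.  typeff follows the typing rules, except that it reads a table that
-- changes during the run: a field type may be read first and enlarged later,
-- which would invalidate what was derived from it.  But all steps enlarge the
-- table.  So for any table T* that lies below the table at the start of a step
-- and above the table at its end, all tables that occur in between are
-- equivalent to T*, and the effects computed from them are derivable with
-- respect to T*.  In this relative form the claim composes along a run of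
-- typeff, along the branches of a let and along a round (Run, BranchesRun,
-- Step).  In the last round the table at the end is equivalent to the one at the
-- start, so that the returned table itself is such a T*.
--
-- Termination.  A table is determined up to equivalence by the finitely many
-- decidable facts "s is in F(C,r,f)" and "the i-th element of the algebra is
-- below the entry of M at this place".  Facts are preserved by enlarging the
-- table, so each round that changes it decreases the number of facts that do
-- not hold (compare).
--
-- Well-formedness holds initially and is restored by each visit.

open import Defs
open import Data.Bool using (true; false) renaming (_≟_ to _≟ᵇ_)
open import Data.Empty using (⊥-elim; ⊥-elim-irr)
open import Data.Fin using (Fin; zero; suc)
open import Data.Fin.Properties using () renaming (_≟_ to _≟ᶠ_)
open import Data.Fin.Subset using (_∈_)
open import Data.Fin.Subset.Properties using (_∈?_)
open import Data.List using (List; []; _∷_; _++_; map; length; filter; allFin; cartesianProduct)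
open import Data.List.Membership.Propositional using (find; lose) renaming (_∈_ to _∈ˡ_)
open import Data.List.Membership.Propositional.Properties
  using (∈-allFin; ∈-cartesianProduct⁺; ∈-map⁺; ∈-++⁺ˡ; ∈-++⁺ʳ; ∈-filter⁺; ∈-filter⁻)
open import Data.List.Relation.Binary.Pointwise using (Pointwise; []; _∷_; Pointwise-≡⇒≡)
open import Data.List.Relation.Binary.Sublist.Propositional using (⊆-refl)
open import Data.List.Relation.Binary.Sublist.Propositional.Properties
  using (filter⁺; length-mono-≤)
open import Data.List.Relation.Binary.Sublist.Heterogeneous.Properties using (toPointwise)
open import Data.List.Relation.Unary.All as All using (All; []; _∷_)
open import Data.List.Relation.Unary.AllPairs using ([]; _∷_)
open import Data.List.Relation.Unary.Any using (here; there; any?)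
open import Data.List.Relation.Unary.Unique.Propositional using (Unique)
open import Data.Maybe using (Maybe; just; nothing; fromMaybe; _>>=_)
open import Data.Nat using (ℕ; _<_)
open import Data.Nat.Induction using (<-wellFounded)
open import Data.Nat.Properties using (≤∧≢⇒<)
open import Data.Product using (∃; ∃-syntax; _×_; _,_; proj₁; proj₂)
open import Data.Sum using (_⊎_; inj₁; inj₂)
open import Data.Vec using (Vec; []; _∷_; toList)
import Data.Vec.Functional as VF
open import Function using (Injective; _∘_)
open import Function.Bundles using (Inverse)
open import Induction.WellFounded using (Acc; acc)
open import Relation.Binary using (Decidable)
import Relation.Binary.Lattice.Properties.JoinSemilattice as JoinProperties
open import Relation.Binary.PropositionalEquality using (_≡_; refl; sym; trans; cong; subst)
open import Relation.Nullary using (¬_; Dec; yes; no)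
open import Relation.Nullary.Decidable using (dec-true; dec-false; map′; ¬?; _×-dec_; decidable-stable)

bind : ∀ {A B : Set} {m : Maybe A} {f : A → Maybe B} {a b} →
       m ≡ just a → f a ≡ just b → (m >>= f) ≡ just b
bind refl q = q

-- A measure for increasing sequences

module _ {X I : Set} {Q : I → X → Set} (Q? : ∀ i x → Dec (Q i x)) (is : List I) where

  missing : X → ℕ
  missing x = length (filter (λ i → ¬? (Q? i x)) is)

  -- Whatever fails at y fails at x, so the facts failing at y are a sublist of
  -- those failing at x; it is a proper one because i is only in the latter.
  missing-decreases : ∀ {x y} → (∀ i → Q i x → Q i y) →
                      ∀ {i} → i ∈ˡ is → Q i y → ¬ Q i x → missing y < missing x
  missing-decreases {x} {y} up {i} i∈ qy ¬qx = ≤∧≢⇒< (length-mono-≤ sublist) different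
    where
    sublist = filter⁺ (λ j → ¬? (Q? j y)) (λ j → ¬? (Q? j x))
                (λ { refl ¬qy q → ¬qy (up _ q) }) (⊆-refl {x = is})
    different : ¬ (missing y ≡ missing x)
    different eq = proj₂ (∈-filter⁻ (λ j → ¬? (Q? j y)) {xs = is} i∈y) qy
      where
      i∈y = subst (i ∈ˡ_) (sym (Pointwise-≡⇒≡ (toPointwise eq sublist)))
              (∈-filter⁺ (λ j → ¬? (Q? j x)) i∈ ¬qx)

-- Definedness from Featherweight Java typing

module _ {N : Names} where
  open Names N

  -- A record, so that both environments can be inferred from its type.
  record Covers {A A′ : Set} (Γ : Env A) (Δ : Env A′) : Set where
    constructor covers
    field
      bound : ∀ {x a} → Γ x ≡ just a → ∃ λ b → Δ x ≡ just b

  open Covers public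

  covers-extend : ∀ {A A′ : Set} {Γ : Env A} {Δ : Env A′} → Covers Γ Δ →
                  ∀ x a b → Covers (Γ [ x ↦ a ]) (Δ [ x ↦ b ])
  covers-extend {Γ = Γ} {Δ} c x a b = covers at
    where
    at : ∀ {y a′} → (Γ [ x ↦ a ]) y ≡ just a′ → ∃ λ b′ → (Δ [ x ↦ b ]) y ≡ just b′
    at {y} p with y ≟ᵛ x
    ... | yes _ = b , refl
    ... | no  _ = bound c p

  covers-params : ∀ {A A′ : Set} {n} (xs : Vec Var n) (as : Vec A n) (bs : Vec A′ n) →
                  Covers [ xs ↦* as ] [ xs ↦* bs ]
  covers-params []       []       []       = covers λ ()
  covers-params (x ∷ xs) (a ∷ as) (b ∷ bs) = covers-extend (covers-params xs as bs) x a b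

module _ {k : ℕ} {N : Names} {P : Program k N} {T₀ : FJClassTable P} where
  open Names N

  var-bound : ∀ {Γ x C} → _⊢₀_∶_ P T₀ Γ (var x) C → ∃ λ D → Γ x ≡ just D
  var-bound (sub d _) = var-bound d
  var-bound (var p)   = _ , p

  lookups-defined : ∀ {A : Set} {Γ : Env Cls} {Δ : Env A} → Covers {N} Γ Δ →
                    ∀ {ys n} (Ds : Vec Cls n) →
                    Pointwise (λ y D → _⊢₀_∶_ P T₀ Γ (var y) D) ys (toList Ds) →
                    ∃ λ as → lookups Δ ys n ≡ just as
  lookups-defined c []       []       = [] , refl
  lookups-defined c (D ∷ Ds) (d ∷ ds) =
    let a  , p = bound c (proj₂ (var-bound d))
        as , q = lookups-defined c Ds ds
    in a ∷ as , bind p (bind q refl)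

-- Orders on effects and tables

module _ {k : ℕ} (B : BüchiAbstraction k) where
  open BüchiAbstraction B
  open Inverse (proj₂ finite*) using (to; from; to-cong; from-cong; strictlyInverseʳ)

  -- The order is decidable because equality in a finite setoid is, and U ≤ V
  -- amounts to U ∨ V ≈ V.
  _≤*?_ : Decidable M*._≤_
  U ≤*? V = map′ (λ e → M*.trans (M*.x≤x∨y U V) (M*.reflexive (≈-from e)))
                 (λ U≤V → to-cong (JoinProperties.x≤y⇒x∨y≈y M* U≤V))
                 (to (U M*.∨ V) ≟ᶠ to V)
    where
    ≈-from : ∀ {U V} → to U ≡ to V → U M*.≈ V
    ≈-from {U} {V} e = M*.Eq.trans (M*.Eq.sym (strictlyInverseʳ U))
                         (M*.Eq.trans (from-cong e) (strictlyInverseʳ V))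

module _ {k : ℕ} (B : BüchiAbstraction k) {N : Names} (P : Program k N)
         (regs : Enumeration (Reg N)) (sigs : Enumeration (Sig P)) where
  open Names N
  open Program P
  open BüchiAbstraction B
  open BüchiTypes B P
  open Inference B P regs sigs

  ⊑-refl : ∀ {K} {T : M⟨ K ⟩} → T ⊑ T
  ⊑-refl = pointwise λ κ → M*.refl

  ⊑ᶠ-refl : ∀ {F} → F ⊑ᶠ F
  ⊑ᶠ-refl C r f p s h = h

  ⊑ᶠ-trans : ∀ {F₁ F₂ F₃} → F₁ ⊑ᶠ F₂ → F₂ ⊑ᶠ F₃ → F₁ ⊑ᶠ F₃
  ⊑ᶠ-trans i j C r f p s h = j C r f p s (i C r f p s h)

  ⊑ᵗ-refl : ∀ {T} → T ⊑ᵗ T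
  ⊑ᵗ-refl {F , M} = ⊑ᶠ-refl {F} , λ σ → ⊑-refl , ⊑-refl

  ⊑ᵗ-trans : ∀ {T₁ T₂ T₃} → T₁ ⊑ᵗ T₂ → T₂ ⊑ᵗ T₃ → T₁ ⊑ᵗ T₃
  ⊑ᵗ-trans {F₁ , _} {F₂ , _} {F₃ , _} (i , i′) (j , j′) =
      ⊑ᶠ-trans {F₁} {F₂} {F₃} i j
    , λ σ → ⊑-trans (proj₁ (i′ σ)) (proj₁ (j′ σ)) , ⊑-trans (proj₂ (i′ σ)) (proj₂ (j′ σ))

  ⊑ᵗ-antisym : ∀ {T T′} → T ⊑ᵗ T′ → T′ ⊑ᵗ T → T ≋ᵗ T′
  ⊑ᵗ-antisym (i , i′) (j , j′) =
      (λ C r f p → ≐ʳ-from-⊆ʳ (i C r f p) (j C r f p))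
    , λ σ → antisym (proj₁ (i′ σ)) (proj₁ (j′ σ)) , antisym (proj₂ (i′ σ)) (proj₂ (j′ σ))
    where
    antisym : ∀ {K} {T T′ : M⟨ K ⟩} → T ⊑ T′ → T′ ⊑ T → T ≋ T′
    antisym (pointwise u) (pointwise v) = pointwise λ κ → M*.antisym (u κ) (v κ)

  ≋ᵗ⇒⊑ᵗ : ∀ {T T′} → T ≋ᵗ T′ → T ⊑ᵗ T′
  ≋ᵗ⇒⊑ᵗ (e , e′) =
      (λ C r f p s h → trans (sym (e C r f p s)) h)
    , λ σ → below (proj₁ (e′ σ)) , below (proj₂ (e′ σ))
    where
    below : ∀ {K} {T T′ : M⟨ K ⟩} → T ≋ T′ → T ⊑ T′
    below (pointwise u) = pointwise λ κ → M*.reflexive (u κ)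

  anyOf-mono : ∀ {A A′} → A ⊆ʳ A′ → anyOf A ⊑ anyOf A′
  anyOf-mono {A} {A′} i = pointwise at
    where
    at : ∀ s → anyOf A ! s M*.≤ anyOf A′ ! s
    at s with A s in eq
    ... | false = ⊥*-least _
    ... | true rewrite i s eq = M*.refl

  !-≤ : ∀ {K V} (T : M⟨ K ⟩) {κ} → T κ ≡ V → T ! κ M*.≤ fromMaybe ⊥* V
  !-≤ T refl = M*.refl

  ≤-single : ∀ r U → U M*.≤ (r & U) ! r
  ≤-single r U with r ≟ʳ r
  ... | yes _  = M*.refl
  ... | no r≢r = ⊥-elim (r≢r refl)

  update-above : ∀ F C r f s → F ⊑ᶠ (F [ C , r , f ∪= s ])
  update-above F C r f s C′ r′ f′ p t h
    with (C ≟ᶠ C′) ×-dec (r ≟ʳ r′) ×-dec (f ≟ᶠ f′)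
  ... | yes _ = ∨-introˡ h
  ... | no  _ = h

  update-∈ : ∀ F C r f s (p : f ∈ fields C) → s ∈ʳ (F [ C , r , f ∪= s ]) C r f p
  update-∈ F C r f s p
    with (C ≟ᶠ C) ×-dec (r ≟ʳ r) ×-dec (f ≟ᶠ f)
  ... | yes _ = ∨-introʳ {F C r f p s} (isYes-intro (s ≟ʳ s) refl)
  ... | no ¬e = ⊥-elim (¬e (refl , refl , refl))

  join-above : ∀ M σ Z → M ⊑ᵐ (M [ σ ⊔= Z ])
  join-above M σ Z σ′ with _≟ˢ_ P σ σ′
  ... | yes _ = ⊔-upperˡ _ _ , ⊔-upperˡ _ _
  ... | no  _ = ⊑-refl , ⊑-refl

  join-∈ : ∀ M σ Z → Z ⊑² ((M [ σ ⊔= Z ]) σ)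
  join-∈ M σ Z with _≟ˢ_ P σ σ
  ... | yes _ = ⊔-upperʳ _ _ , ⊔-upperʳ _ _
  ... | no ¬e = ⊥-elim (¬e refl)

  -- Soundness of effect inference

  -- As F ⊑ᶠ F′ holds for the field tables before and after a run, this makes all
  -- field tables that occur during the run equivalent to F*.
  Between : Table → MethodTable → FieldTable → FieldTable → Set
  Between (F* , M*) M F F′ = F* ⊑ᶠ F × F′ ⊑ᶠ F* × M* ⊑ᵐ M

  module _ (M : MethodTable) where

    record Run (F : FieldTable) (Γ : Env (Reg N)) (e : Expr k N) : Set where
      constructor run
      field
        {F′}  : FieldTable
        {T}   : Type
        {S}   : Calls
        runs  : typeff M F Γ e ≡ just (F′ , T , S)
        grows : F ⊑ᶠ F′
        typed : ∀ T* → Between T* M F F′ → _⊢_∶_calls_ T* Γ e T S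

    -- The alternatives rᵢ & Uᵢ of the let rule are the defined entries of T, in
    -- the order of rs.  The branches are typed separately because the let rule
    -- takes their typings as a family indexed by i.
    record BranchesRun (F : FieldTable) (Γ : Env (Reg N)) (x : Var) (T : Type) (e : Expr k N)
                       (rs : List (Reg N)) : Set where
      constructor branchesRun
      field
        {F′}  : FieldTable
        {n}   : ℕ
        {r}   : Fin n → Reg N
        {U}   : Fin n → M*.Carrier
        {Ts}  : Fin n → Type
        {Ss}  : Fin n → Calls
        runs  : branches M F Γ x T e rs ≡
                just (F′ , (⨆ λ i → U i ·ᵉ Ts i) , (⨆ λ i → U i ·ᵉ Ss i))
        grows : F ⊑ᶠ F′
        r∈    : ∀ i → r i ∈ˡ rs
        r-inj : Injective _≡_ _≡_ r
        above : ∀ {κ} → κ ∈ˡ rs → T ! κ M*.≤ alternatives r U ! κ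
        typed : ∀ T* → Between T* M F F′ → ∀ i → _⊢_∶_calls_ T* (Γ [ x ↦ r i ]) e (Ts i) (Ss i)

    branches-nothing : ∀ {F Γ x T e r rs} → T r ≡ nothing →
                       branches M F Γ x T e (r ∷ rs) ≡ branches M F Γ x T e rs
    branches-nothing eq rewrite eq = refl

    branches-just : ∀ {F Γ x T e r rs U F₁ T₁ S₁ F₂ T₂ S₂} → T r ≡ just U →
                    typeff M F (Γ [ x ↦ r ]) e ≡ just (F₁ , T₁ , S₁) →
                    branches M F₁ Γ x T e rs ≡ just (F₂ , T₂ , S₂) →
                    branches M F Γ x T e (r ∷ rs) ≡ just (F₂ , U ·ᵉ T₁ ⊔ᵉ T₂ , U ·ᵉ S₁ ⊔ᵉ S₂)
    branches-just eq p q rewrite eq = bind p (bind q refl)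

    -- The table at the end of one branch is the one at the start of the next, so
    -- the bounds on T* for the whole run give those for each branch by
    -- monotonicity.
    branches-sound : ∀ {Γ x e} T → (∀ r F → Run F (Γ [ x ↦ r ]) e) →
                     ∀ {rs} → Unique rs → ∀ F → BranchesRun F Γ x T e rs
    branches-sound T runE [] F = branchesRun {n = 0} {r = λ ()} {U = λ ()} {Ts = λ ()} {Ss = λ ()}
      refl (⊑ᶠ-refl {F}) (λ ()) (λ { {()} }) (λ ()) (λ _ _ ())
    branches-sound {Γ} {x} {e} T runE {ρ ∷ rs} (ρ∉ ∷ uniq) F with T ρ in eq
    ... | nothing = let open BranchesRun (branches-sound T runE uniq F) in
      branchesRun (trans (branches-nothing {F} {Γ} {x} {T} {e} {ρ} {rs} eq) runs)
        grows (there ∘ r∈) r-inj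
        (λ { (here refl) → M*.trans (!-≤ T eq) (⊥*-least _)
           ; (there κ∈)  → above κ∈ })
        typed
    ... | just V = branchesRun
        {r = ρ VF.∷ R.r} {U = V VF.∷ R.U} {Ts = E.T VF.∷ R.Ts} {Ss = E.S VF.∷ R.Ss}
        (branches-just {F} {Γ} {x} {T} {e} {ρ} {rs} eq E.runs R.runs)
        (⊑ᶠ-trans {F} {E.F′} {R.F′} E.grows R.grows)
        (λ { zero → here refl ; (suc i) → there (R.r∈ i) })
        inj
        above
        λ { T* (lo , hi , m) zero    → E.typed T* (lo , ⊑ᶠ-trans {E.F′} {R.F′} {proj₁ T*} R.grows hi , m)
          ; T* (lo , hi , m) (suc i) → R.typed T* (⊑ᶠ-trans {proj₁ T*} {F} {E.F′} lo E.grows , hi , m) i }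
      where
      module E = Run (runE ρ F)
      module R = BranchesRun (branches-sound T runE uniq E.F′)
      inj : Injective _≡_ _≡_ (ρ VF.∷ R.r)
      inj {zero}  {zero}  _ = refl
      inj {zero}  {suc j} p = ⊥-elim (All.lookup ρ∉ (R.r∈ j) p)
      inj {suc i} {zero}  p = ⊥-elim (All.lookup ρ∉ (R.r∈ i) (sym p))
      inj {suc i} {suc j} p = cong suc (R.r-inj p)
      above : ∀ {κ} → κ ∈ˡ (ρ ∷ rs) → T ! κ M*.≤ alternatives (ρ VF.∷ R.r) (V VF.∷ R.U) ! κ
      above (here refl) = M*.trans (M*.trans (!-≤ T eq) (≤-single ρ V))
                            (_⊑_.at (⊔-upperˡ (ρ & V) (alternatives R.r R.U)) ρ)
      above {κ} (there κ∈) = M*.trans (R.above κ∈)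
                               (_⊑_.at (⊔-upperʳ (ρ & V) (alternatives R.r R.U)) κ)

    ifeq-disjoint : ∀ {F Γ x y r s e₁ e₂} → Γ x ≡ just r → Γ y ≡ just s → Disjoint r s →
                    typeff M F Γ (ifeq x y e₁ e₂) ≡ typeff M F Γ e₂
    ifeq-disjoint {r = r} {s} p q d rewrite p | q | dec-true (disjoint? r s) d = refl

    ifeq-overlapping : ∀ {F Γ x y r s e₁ e₂ F₁ T₁ S₁ F₂ T₂ S₂} →
                       Γ x ≡ just r → Γ y ≡ just s → ¬ Disjoint r s →
                       typeff M F Γ e₁ ≡ just (F₁ , T₁ , S₁) →
                       typeff M F₁ Γ e₂ ≡ just (F₂ , T₂ , S₂) →
                       typeff M F Γ (ifeq x y e₁ e₂) ≡ just (F₂ , T₁ ⊔ᵉ T₂ , S₁ ⊔ᵉ S₂)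
    ifeq-overlapping {r = r} {s} p q ¬d t₁ t₂ rewrite p | q | dec-false (disjoint? r s) ¬d =
      bind t₁ (bind t₂ refl)

    get-runs : ∀ {F Γ x C f r} (p : f ∈ fields C) → Γ x ≡ just r →
               typeff M F Γ (get x C f) ≡ just (F , anyOf (F C r f p) , ∅)
    get-runs {C = C} {f} p q with f ∈? fields C
    ... | yes _ = bind q refl
    ... | no f∉ = ⊥-elim (f∉ p)

    set-runs : ∀ {F Γ x C f y r s} → f ∈ fields C → Γ x ≡ just r → Γ y ≡ just s →
               typeff M F Γ (set x C f y) ≡ just ((F [ C , r , f ∪= s ]) , s & ε* , ∅)
    set-runs {C = C} {f} p q q′ with f ∈? fields C
    ... | yes _ = bind q (bind q′ refl)
    ... | no f∉ = ⊥-elim (f∉ p)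

    call-runs : ∀ {F Γ x C m ys r ss} (p : m ∈ methods C) →
                Γ x ≡ just r → lookups Γ ys (ar m) ≡ just ss →
                typeff M F Γ (call x C m ys) ≡
                just (F , proj₁ (M (sig C r m ss p)) , ⟪ sig C r m ss p ⟫)
    call-runs {C = C} {m} p q q′ with m ∈? methods C
    ... | yes _ = bind q (bind q′ refl)
    ... | no m∉ = ⊥-elim (m∉ p)

    -- Subsumption in the FJ derivation is skipped, as it changes only the class
    -- of e, which typeff does not consult.  The effect rule (sub) is needed where
    -- the table is read (get, call), as the entry of T* is only below the one that
    -- was read, and in a let, where the alternatives list the type of e₁ entry by
    -- entry.
    typeff-sound : ∀ {T₀ Γ₀ e C} → _⊢₀_∶_ P T₀ Γ₀ e C →
                   ∀ {Γ} → Covers {N} Γ₀ Γ → ∀ F → Run F Γ e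
    typeff-sound (sub d _) c F = typeff-sound d c F
    typeff-sound (var p)   c F = let r , q = bound c p in
      run (bind q refl) (⊑ᶠ-refl {F}) (λ _ _ → var q)
    typeff-sound null      c F = run refl (⊑ᶠ-refl {F}) (λ _ _ → null)
    typeff-sound emit      c F = run refl (⊑ᶠ-refl {F}) (λ _ _ → prim)
    typeff-sound new       c F = run refl (⊑ᶠ-refl {F}) (λ _ _ → new)
    typeff-sound (cast d)  c F = let open Run (typeff-sound d c F) in
      run runs grows (λ T* b → cast (typed T* b))
    typeff-sound (letin {x = x} d₁ d₂) {Γ} c F = run
        (bind E₁.runs (bind E₂.runs refl))
        (⊑ᶠ-trans {F} {E₁.F′} {E₂.F′} E₁.grows E₂.grows)
        λ { T* (lo , hi , m) →
              letin E₂.r E₂.U E₂.r-inj E₂.Ts E₂.Ss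
                (sub (E₁.typed T* (lo , ⊑ᶠ-trans {E₁.F′} {E₂.F′} {proj₁ T*} E₂.grows hi , m))
                     (pointwise λ κ → E₂.above (Enumeration.complete regs κ)) ⊑-refl)
                (E₂.typed T* (⊑ᶠ-trans {proj₁ T*} {F} {E₁.F′} lo E₁.grows , hi , m)) }
      where
      module E₁ = Run (typeff-sound d₁ c F)
      module E₂ = BranchesRun (branches-sound E₁.T (λ r → typeff-sound d₂ (covers-extend c x _ r))
                                 (Enumeration.unique regs) E₁.F′)
    typeff-sound (ifeq {x = x} {y} {e₁} {e₂} dx dy d₁ d₂) {Γ} c F
      with bound c (proj₂ (var-bound dx)) | bound c (proj₂ (var-bound dy))
    ... | r , p | s , q with disjoint? r s
    ... | yes dis = let open Run (typeff-sound d₂ c F) in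
      run (trans (ifeq-disjoint {F} {Γ} {x} {y} {e₁ = e₁} {e₂} p q dis) runs) grows
        (λ T* b → else p q dis (typed T* b))
    ... | no ¬dis = run
        (ifeq-overlapping {F} {Γ} {x} {y} {e₁ = e₁} {e₂} p q ¬dis E₁.runs E₂.runs)
        (⊑ᶠ-trans {F} {E₁.F′} {E₂.F′} E₁.grows E₂.grows)
        λ { T* (lo , hi , m) →
              ifeq p q (E₁.typed T* (lo , ⊑ᶠ-trans {E₁.F′} {E₂.F′} {proj₁ T*} E₂.grows hi , m))
                       (E₂.typed T* (⊑ᶠ-trans {proj₁ T*} {F} {E₁.F′} lo E₁.grows , hi , m)) }
      where
      module E₁ = Run (typeff-sound d₁ c F)
      module E₂ = Run (typeff-sound d₂ c E₁.F′)
    typeff-sound (get {C = C} {f} dx p) c F = let r , q = bound c (proj₂ (var-bound dx)) in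
      run (get-runs p q) (⊑ᶠ-refl {F})
        λ { T* (lo , _ , _) → sub (get q p) (anyOf-mono (lo C r f p)) ⊑-refl }
    typeff-sound (set {C = C} {f} dx p dy) c F =
      let r , q  = bound c (proj₂ (var-bound dx))
          s , q′ = bound c (proj₂ (var-bound dy))
      in run (set-runs p q q′) (update-above F C r f s)
           λ { T* (_ , hi , _) → set q q′ p (hi C r f p s (update-∈ F C r f s p)) }
    typeff-sound (call dx p dys) c F =
      let r  , q  = bound c (proj₂ (var-bound dx))
          ss , q′ = lookups-defined c _ dys
      in run (call-runs p q q′) (⊑ᶠ-refl {F})
           λ { T* (_ , _ , m) → sub (call q q′ p) (proj₁ (m _)) ⊑-refl }

  -- Soundness of a round

  TypedAt : Table → Sig P → Set
  TypedAt (F , M) σ@(sig C r m ss p) = _∈Cls_ P C r →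
    let open Method (mtable C m p) in
    _⊢_∶_calls_ (F , M) [ this ∷ params ↦* r ∷ ss ] body (proj₁ (M σ)) (proj₂ (M σ))

  record Step (f : Table → Maybe Table) (σs : List (Sig P)) (T : Table) : Set where
    constructor step
    field
      {T′}       : Table
      runs       : f T ≡ just T′
      grows      : T ⊑ᵗ T′
      wellFormed : WellFormed T → WellFormed T′
      typed      : ∀ T* → T* ⊑ᵗ T → T′ ⊑ᵗ T* → All (TypedAt T*) σs

  module _ (T₀ : FJClassTable P) (wt : FJWellTyped P T₀) where

    -- The effects of the body were joined to the entry of σ and closing the table
    -- only enlarges it, so they lie below the entry of σ in every table above the
    -- result.
    visit-sound : ∀ σ T → Step (visit σ) (σ ∷ []) T
    visit-sound σ@(sig C r m ss p) (F , M) with m ∈? methods C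
    -- p is irrelevant; the FJ typing needs the relevant proof q.
    ... | no m∉ = ⊥-elim-irr (m∉ p)
    ... | yes q with _∈Cls?_ P C r in eq
    ...   | no C∉ = step (skip eq) ⊑ᵗ-refl (λ wf → wf) (λ _ _ _ → (λ C∈ → ⊥-elim (C∉ C∈)) ∷ [])
      where
      skip : ∀ {d} → _∈Cls?_ P C r ≡ no d → visit σ (F , M) ≡ just (F , M)
      skip eq rewrite eq = refl
    ...   | yes C∈ = step (infer eq) above
        (λ _ → checkClassTable-wellFormed joined)
        λ T* lo hi →
          (λ _ → let hi′ = ⊑ᵗ-trans closed hi in
            sub (E.typed T* (proj₁ lo , proj₁ hi′ , proj₂ lo))
              (⊑-trans (proj₁ (join-∈ M σ (E.T , E.S))) (proj₁ (proj₂ hi′ σ)))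
              (⊑-trans (proj₂ (join-∈ M σ (E.T , E.S))) (proj₂ (proj₂ hi′ σ))))
          ∷ []
      where
      open Method (mtable C m p)
      module E = Run (typeff-sound M (wt C m q)
                   (covers-params (this ∷ params) (C ∷ proj₁ (FJClassTable.M₀ T₀ C m q)) (r ∷ ss)) F)
      joined : Table
      joined = E.F′ , (M [ σ ⊔= (E.T , E.S) ])
      infer : ∀ {d} → _∈Cls?_ P C r ≡ yes d → visit σ (F , M) ≡ just (checkClassTable joined)
      infer eq rewrite eq = bind E.runs refl
      closed : joined ⊑ᵗ checkClassTable joined
      closed = checkClassTable-above joined
      above : (F , M) ⊑ᵗ checkClassTable joined
      above = ⊑ᵗ-trans {F , M} {joined} (E.grows , join-above M σ (E.T , E.S)) closed

    visitAll-sound : ∀ σs T → Step (visitAll σs) σs T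
    visitAll-sound []       T = step refl ⊑ᵗ-refl (λ wf → wf) (λ _ _ _ → [])
    visitAll-sound (σ ∷ σs) T = step
        (bind V.runs R.runs)
        (⊑ᵗ-trans V.grows R.grows)
        (λ wf → R.wellFormed (V.wellFormed wf))
        λ T* lo hi → All.head (V.typed T* lo (⊑ᵗ-trans R.grows hi))
                     ∷ R.typed T* (⊑ᵗ-trans lo V.grows) hi
      where
      module V = Step (visit-sound σ T)
      module R = Step (visitAll-sound σs V.T′)

  -- Termination

  Size : ℕ
  Size = proj₁ finite*

  open Inverse (proj₂ finite*) using (to; from; strictlyInverseʳ)

  -- The elements of the algebra occur through their numbers in Fin Size, as they
  -- can be listed only up to equivalence.
  data Fact : Set where
    inField : Cls × Reg N × Fld × Reg N → Fact
    inType  : Sig P × Reg N × Fin Size → Fact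
    inCalls : Sig P × Sig P × Fin Size → Fact

  Holds : Fact → Table → Set
  Holds (inField (C , r , f , s)) (F , _) = entry F C r f s ≡ true
  Holds (inType  (σ , r , i))     (_ , M) = from i M*.≤ proj₁ (M σ) ! r
  Holds (inCalls (σ , τ , i))     (_ , M) = from i M*.≤ proj₂ (M σ) ! τ

  holds? : ∀ φ T → Dec (Holds φ T)
  holds? (inField (C , r , f , s)) (F , _) = entry F C r f s ≟ᵇ true
  holds? (inType  (σ , r , i))     (_ , M) = _≤*?_ B (from i) (proj₁ (M σ) ! r)
  holds? (inCalls (σ , τ , i))     (_ , M) = _≤*?_ B (from i) (proj₂ (M σ) ! τ)

  fieldFacts typeFacts callFacts facts : List Fact
  fieldFacts = map inField (cartesianProduct (allFin #Cls)
    (cartesianProduct (Enumeration.list regs) (cartesianProduct (allFin #Fld) (Enumeration.list regs))))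
  typeFacts  = map inType (cartesianProduct (Enumeration.list sigs)
    (cartesianProduct (Enumeration.list regs) (allFin Size)))
  callFacts  = map inCalls (cartesianProduct (Enumeration.list sigs)
    (cartesianProduct (Enumeration.list sigs) (allFin Size)))
  facts      = fieldFacts ++ typeFacts ++ callFacts

  facts-complete : ∀ φ → φ ∈ˡ facts
  facts-complete (inField (C , r , f , s)) =
    ∈-++⁺ˡ (∈-map⁺ inField (∈-cartesianProduct⁺ (∈-allFin C)
      (∈-cartesianProduct⁺ (Enumeration.complete regs r)
        (∈-cartesianProduct⁺ (∈-allFin f) (Enumeration.complete regs s)))))
  facts-complete (inType (σ , r , i)) =
    ∈-++⁺ʳ fieldFacts (∈-++⁺ˡ (∈-map⁺ inType (∈-cartesianProduct⁺ (Enumeration.complete sigs σ)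
      (∈-cartesianProduct⁺ (Enumeration.complete regs r) (∈-allFin i)))))
  facts-complete (inCalls (σ , τ , i)) =
    ∈-++⁺ʳ fieldFacts (∈-++⁺ʳ typeFacts (∈-map⁺ inCalls (∈-cartesianProduct⁺ (Enumeration.complete sigs σ)
      (∈-cartesianProduct⁺ (Enumeration.complete sigs τ) (∈-allFin i)))))

  Holds-mono : ∀ {T T′} → T ⊑ᵗ T′ → ∀ φ → Holds φ T → Holds φ T′
  Holds-mono {F , _} {F′ , _} (i , _) (inField (C , r , f , s)) h =
    let p , s∈ = entry-∈ F C r f s h in trans (entry-≡ F′ C r f s p) (i C r f p s s∈)
  Holds-mono (_ , i) (inType (σ , r , _))  h = M*.trans h (_⊑_.at (proj₁ (i σ)) r)
  Holds-mono (_ , i) (inCalls (σ , τ , _)) h = M*.trans h (_⊑_.at (proj₂ (i σ)) τ)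

  -- The facts about an entry U include that the representative of U is below it,
  -- and this fact alone forces U below any entry that has it as well.
  Holds-reflects : ∀ {T T′} → (∀ φ → Holds φ T → Holds φ T′) → T ⊑ᵗ T′
  Holds-reflects {F , M} {F′ , M′} h =
      (λ C r f p s s∈ → trans (sym (entry-≡ F′ C r f s p))
                          (h (inField (C , r , f , s)) (trans (entry-≡ F C r f s p) s∈)))
    , λ σ → pointwise (λ r → below (h (inType (σ , r , _))))
          , pointwise (λ τ → below (h (inCalls (σ , τ , _))))
    where
    below : ∀ {U V} → (from (to U) M*.≤ U → from (to U) M*.≤ V) → U M*.≤ V
    below {U} g = M*.trans (M*.reflexive (M*.Eq.sym (strictlyInverseʳ U)))
                    (g (M*.reflexive (strictlyInverseʳ U)))

  rank : Table → ℕ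
  rank = missing holds? facts

  -- Searching the finite list for a gained fact decides whether the iteration
  -- stops, and a fact that is found makes the rank decrease.
  compare : ∀ {T T′} → T ⊑ᵗ T′ → T′ ⊑ᵗ T ⊎ ¬ (T′ ⊑ᵗ T) × rank T′ < rank T
  compare {T} {T′} T⊑T′ with any? (λ φ → holds? φ T′ ×-dec ¬? (holds? φ T)) facts
  ... | yes gained = let φ , φ∈ , h , ¬h = find gained in
    inj₂ ( (λ T′⊑T → ¬h (Holds-mono T′⊑T φ h))
         , missing-decreases holds? facts (Holds-mono T⊑T′) φ∈ h ¬h)
  ... | no none = inj₁ (Holds-reflects λ φ h →
    decidable-stable (holds? φ T) λ ¬h → none (lose (facts-complete φ) (h , ¬h)))

  initial-wellFormed : WellFormed initial
  initial-wellFormed = record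
    { null-∈    = λ C r f p → refl
    ; ⊆-unknown = λ C r f p s h → h
    ; F-class   = λ C⪯D r f p q s → refl
    ; M-class   = λ C⪯D r m ss p q → ⊑-refl , ⊑-refl
    }

  module _ (T₀ : FJClassTable P) (wt : FJWellTyped P T₀) where

    -- At the end the table T′ returned by the last round plays the role of T*: it
    -- is above itself, and it is below T because the round changed nothing.
    iterate : ∀ T → Acc _<_ (rank T) → WellFormed T →
              ∃[ T′ ] (T ⇓ T′ × WellFormed T′ × WellTyped T′)
    iterate T (acc rec) wf with visitAll-sound T₀ wt (Enumeration.list sigs) T
    ... | step {T′} runs grows wf-step typed with compare grows
    ... | inj₁ T′⊑T =
      T′ , stop runs (⊑ᵗ-antisym T′⊑T grows) , wf-step wf
      , λ C r m ss p → All.lookup (typed T′ T′⊑T ⊑ᵗ-refl)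
                          (Enumeration.complete sigs (sig C r m ss p))
    ... | inj₂ (¬T′⊑T , smaller) =
      let T″ , T′⇓T″ , sound = iterate T′ (rec smaller) (wf-step wf)
      in T″ , again runs (λ e → ¬T′⊑T (≋ᵗ⇒⊑ᵗ e)) T′⇓T″ , sound

theorem5p11 : (k : ℕ) (B : BüchiAbstraction k) (𝔄 : Lang≤ω k) → Faithful B 𝔄 →
    (N : Names) (P : Program k N) (T₀ : FJClassTable P) → FJWellTyped P T₀ →
    (regs : Enumeration (Reg N)) (sigs : Enumeration (Sig P)) →
    ∃[ T ] (Inference.Returns B P regs sigs T
    × BüchiTypes.WellFormed B P T
    × BüchiTypes.WellTyped B P T)
theorem5p11 k B 𝔄 _ N P T₀ wt regs sigs =
  iterate B P regs sigs T₀ wt initial (<-wellFounded _) (initial-wellFormed B P regs sigs)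
  where open Inference B P regs sigs using (initial)
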